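{- Let $G$ be a $d$-dimensional simplicial complex and let $(F,R)$ be a rooted forest of $G$. The number of fitting orientations of $(F,R)$ is greater than or equal to $|H_{d-1}(F,R)|$. In particular, any rooted forest admits a fitting orientation.
   Context: A simplicial complex on $n$ vertices is a nonempty collection $G$ of subsets of $[n]=\{1,\dots,n\}$ closed under taking subsets; its elements are called faces. A $k$-face is a face of cardinality $k+1$ (so $\emptyset$ is the $(-1)$-face), $G_k$ is the set of $k$-faces, and the dimension $d\ge 0$ of $G$ is the maximal dimension of its faces. Incidence matrix: for $k\ge 0$, $\partial_k^{G}$ is the matrix with rows indexed by $G_{k-1}$ and columns indexed by $G_k$ whose entry $\partial_k^{G}[r,f]$ is $(-1)^j$ if $f=\{v_0,\dots,v_k\}$ with $v_0<\cdots<v_k$ and $r=f\setminus\{v_j\}$, and $0$ if $r\not\subset f$. It is also viewed as the boundary map sending combinations of $k$-faces to combinations of $(k-1)$-faces. A subset $F\subseteq G_d$ is a forest of $G$ if the columns of $\partial_d^{G}$ indexed by $F$ are linearly independent (over $\mathbb{R}$). For $R\subseteq G_{d-1}$ write $\overline{R}=G_{d-1}\setminus R$. For a forest $F$, let $\partial_d^{F}$ be the submatrix of $\partial_d^{G}$ with columns indexed by $F$ and all rows indexed by $G_{d-1}$; $R$ is a root of $F$ if the rows of $\partial_d^{F}$ indexed by $\overline{R}$ form a basis of the row space of $\partial_d^{F}$. A rooted forest of $G$ is a pair $(F,R)$ where $F\subseteq G_d$ is a forest of $G$ (possibly empty) and $R\subseteq G_{d-1}$ is a root of $F$. Relative homology: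 for $F\subseteq G_d$ and $R\subseteq G_{d-1}$, let $\Psi_{F,R}:\mathbb{Z}F\to \mathbb{Z}G_{d-1}/\mathbb{Z}R$ be the group homomorphism $x\mapsto \partial_d^{G}(x)+\mathbb{Z}R$, where $\mathbb{Z}S$ denotes the free abelian group on a set $S$. Then $H_{d-1}(F,R)=\operatorname{coker}\Psi_{F,R}=(\mathbb{Z}G_{d-1}/\mathbb{Z}R)/\operatorname{Im}(\Psi_{F,R})$, and $|H_{d-1}(F,R)|$ is its cardinality. A fitting orientation of a rooted forest $(F,R)$ is a bijection $\phi:\overline{R}\to F$ such that $r\subset\phi(r)$ for every $r\in\overline{R}$. -}

module Defs where

open import Level using (0ℓ)
open import Function.Bundles using (Inverse; Bijection; _⤖_)
open import Data.Bool.Base using (Bool; _∧_; not; T)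
open import Data.Product.Base using (Σ-syntax; ∃-syntax; _×_; _,_; proj₁; proj₂)
open import Data.Nat.Base as ℕ using (ℕ; zero; suc)
import Data.Nat.Properties as ℕ
open import Data.Integer.Base as ℤ using (ℤ; 0ℤ; -1ℤ)
import Data.Integer.Properties as ℤ
open import Data.Rational.Base as ℚ using (ℚ; 0ℚ; 1ℚ; ½)
import Data.Rational.Properties as ℚ
import Data.Rational.Solver as ℚ
open import Data.Fin.Base using (Fin; zero; suc)
open import Data.Fin.Properties using (any?)
open import Data.Fin.Subset using (Subset; inside; outside; _∈_; _⊆_; _⊂_; _-_; ∣_∣)
open import Data.Fin.Subset.Properties using (_∈?_)
open import Data.Vec.Base using ([]; _∷_)
open import Data.Vec.Properties using (≡-dec)
open import Data.List.Base as List using (List; _++_)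
import Data.Bool.Properties as Bool
import Data.Maybe.Base as Maybe
open import Relation.Nullary.Decidable using (yes; no; dec⇒maybe; T?; _×-dec_)
open import Relation.Unary using (Pred)
open import Relation.Binary.Bundles using (Setoid)
open import Relation.Binary.Structures using (IsEquivalence)
open import Relation.Binary.PropositionalEquality
  using (_≡_; refl; sym; trans; cong; subst; setoid)
open import Algebra.Bundles using (AbelianGroup; CommutativeMonoid; CommutativeRing)
open import Algebra.Morphism.Bundles using (GroupHomomorphism)
import Algebra.Morphism.Construct.Composition as Composition
import Algebra.Construct.Pointwise as Pointwise
import Algebra.Properties.AbelianGroup as AbelianGroupProperties
import Algebra.Properties.CommutativeSemigroup as CommutativeSemigroupProperties
import Algebra.Properties.CommutativeMonoid.Sum as Sum
import Relation.Binary.Reasoning.Setoid as SetoidReasoning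

-- The real numbers: Cauchy sequences of rationals with explicit moduli,
-- two sequences being equal when their difference tends to zero.

module Reals where

  Cauchy : (ℕ → ℚ) → Set
  Cauchy x = ∀ ε → 0ℚ ℚ.< ε →
    ∃[ N ] (∀ m n → N ℕ.≤ m → N ℕ.≤ n → ℚ.∣ x m ℚ.- x n ∣ ℚ.< ε)

  record ℝ : Set where
    constructor mkℝ
    field
      seq    : ℕ → ℚ
      cauchy : Cauchy seq

  open ℝ public

  infix 4 _≈_
  _≈_ : ℝ → ℝ → Set
  x ≈ y = ∀ ε → 0ℚ ℚ.< ε →
    ∃[ N ] (∀ n → N ℕ.≤ n → ℚ.∣ seq x n ℚ.- seq y n ∣ ℚ.< ε)

  private
    open ℚ.+-*-Solver

    half : ∀ {ε} → 0ℚ ℚ.< ε → 0ℚ ℚ.< ½ ℚ.* ε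
    half {ε} 0<ε = subst (ℚ._< ½ ℚ.* ε) (ℚ.*-zeroʳ ½) (ℚ.*-monoʳ-<-pos ½ 0<ε)

    half+half : ∀ ε → ½ ℚ.* ε ℚ.+ ½ ℚ.* ε ≡ ε
    half+half ε = trans (sym (ℚ.*-distribʳ-+ ε ½ ½)) (ℚ.*-identityˡ ε)

    +-small : ∀ {ε} a b → ℚ.∣ a ∣ ℚ.< ½ ℚ.* ε → ℚ.∣ b ∣ ℚ.< ½ ℚ.* ε →
              ℚ.∣ a ℚ.+ b ∣ ℚ.< ε
    +-small {ε} a b a< b< = ℚ.≤-<-trans (ℚ.∣p+q∣≤∣p∣+∣q∣ a b)
      (subst (ℚ.∣ a ∣ ℚ.+ ℚ.∣ b ∣ ℚ.<_) (half+half ε) (ℚ.+-mono-< a< b<))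

    -- The tolerance on b for which ∣ a * b ∣ < ε whenever ∣ a ∣ < B.
    tol : ∀ B → 0ℚ ℚ.< B → ℚ → ℚ
    tol B 0<B ε = (ℚ.1/ B) {{ℚ.pos⇒nonZero B {{ℚ.positive 0<B}}}} ℚ.* ε

    tol-pos : ∀ B (0<B : 0ℚ ℚ.< B) {ε} → 0ℚ ℚ.< ε → 0ℚ ℚ.< tol B 0<B ε
    tol-pos B 0<B {ε} 0<ε =
      subst (ℚ._< tol B 0<B ε) (ℚ.*-zeroʳ B⁻¹)
        (ℚ.*-monoʳ-<-pos B⁻¹ {{ℚ.1/pos⇒pos B {{ℚ.positive 0<B}}}} 0<ε)
      where B⁻¹ = (ℚ.1/ B) {{ℚ.pos⇒nonZero B {{ℚ.positive 0<B}}}}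

    *-small : ∀ {ε} B (0<B : 0ℚ ℚ.< B) a b →
              ℚ.∣ a ∣ ℚ.< B → ℚ.∣ b ∣ ℚ.< tol B 0<B ε → ℚ.∣ a ℚ.* b ∣ ℚ.< ε
    *-small {ε} B 0<B a b a< b< = begin-strict
      ℚ.∣ a ℚ.* b ∣         ≡⟨ ℚ.∣p*q∣≡∣p∣*∣q∣ a b ⟩
      ℚ.∣ a ∣ ℚ.* ℚ.∣ b ∣   ≤⟨ ℚ.*-monoʳ-≤-nonNeg ℚ.∣ b ∣ {{ℚ.∣-∣-nonNeg b}} (ℚ.<⇒≤ a<) ⟩
      B ℚ.* ℚ.∣ b ∣         <⟨ ℚ.*-monoʳ-<-pos B {{B-pos}} b< ⟩
      B ℚ.* (B⁻¹ ℚ.* ε)     ≡⟨ sym (ℚ.*-assoc B B⁻¹ ε) ⟩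
      (B ℚ.* B⁻¹) ℚ.* ε     ≡⟨ cong (ℚ._* ε) (ℚ.*-inverseʳ B {{B-nz}}) ⟩
      1ℚ ℚ.* ε              ≡⟨ ℚ.*-identityˡ ε ⟩
      ε                     ∎
      where
      open ℚ.≤-Reasoning
      B-pos = ℚ.positive 0<B
      B-nz  = ℚ.pos⇒nonZero B {{B-pos}}
      B⁻¹   = (ℚ.1/ B) {{B-nz}}

    Bounded : (ℕ → ℚ) → Set
    Bounded x = Σ[ B ∈ ℚ ] 0ℚ ℚ.< B × ∃[ N ] (∀ n → N ℕ.≤ n → ℚ.∣ x n ∣ ℚ.< B)

    bounded : ∀ x → Bounded (seq x)
    bounded x = 1ℚ ℚ.+ ℚ.∣ xN ∣ , B-pos , N , below
      where
      N     = proj₁ (cauchy x 1ℚ (ℚ.positive⁻¹ 1ℚ))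
      close = proj₂ (cauchy x 1ℚ (ℚ.positive⁻¹ 1ℚ))
      xN    = seq x N
      B-pos : 0ℚ ℚ.< 1ℚ ℚ.+ ℚ.∣ xN ∣
      B-pos = ℚ.+-mono-<-≤ (ℚ.positive⁻¹ 1ℚ) (ℚ.0≤∣p∣ xN)
      below : ∀ n → N ℕ.≤ n → ℚ.∣ seq x n ∣ ℚ.< 1ℚ ℚ.+ ℚ.∣ xN ∣
      below n N≤n = subst (λ q → ℚ.∣ q ∣ ℚ.< 1ℚ ℚ.+ ℚ.∣ xN ∣)
        (solve 2 (λ a b → (a :- b) :+ b := a) refl (seq x n) xN)
        (ℚ.≤-<-trans (ℚ.∣p+q∣≤∣p∣+∣q∣ (seq x n ℚ.- xN) xN)
          (ℚ.+-monoˡ-< ℚ.∣ xN ∣ (close n N N≤n ℕ.≤-refl)))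

    -- a b − a′ b′ = a (b − b′) + b′ (a − a′)
    *-close : ∀ {ε} A (0<A : 0ℚ ℚ.< A) B (0<B : 0ℚ ℚ.< B) a b a′ b′ →
              ℚ.∣ a ∣ ℚ.< A → ℚ.∣ b′ ∣ ℚ.< B →
              ℚ.∣ b ℚ.- b′ ∣ ℚ.< tol A 0<A (½ ℚ.* ε) →
              ℚ.∣ a ℚ.- a′ ∣ ℚ.< tol B 0<B (½ ℚ.* ε) →
              ℚ.∣ a ℚ.* b ℚ.- a′ ℚ.* b′ ∣ ℚ.< ε
    *-close {ε} A 0<A B 0<B a b a′ b′ a< b′< bb′ aa′ =
      subst (λ q → ℚ.∣ q ∣ ℚ.< ε)
        (solve 4 (λ a b a′ b′ → a :* (b :- b′) :+ b′ :* (a :- a′) := a :* b :- a′ :* b′)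
               refl a b a′ b′)
        (+-small (a ℚ.* (b ℚ.- b′)) (b′ ℚ.* (a ℚ.- a′))
          (*-small A 0<A a (b ℚ.- b′) a< bb′)
          (*-small B 0<B b′ (a ℚ.- a′) b′< aa′))

    +-close : ∀ {ε} a b a′ b′ →
              ℚ.∣ a ℚ.- a′ ∣ ℚ.< ½ ℚ.* ε → ℚ.∣ b ℚ.- b′ ∣ ℚ.< ½ ℚ.* ε →
              ℚ.∣ (a ℚ.+ b) ℚ.- (a′ ℚ.+ b′) ∣ ℚ.< ε
    +-close {ε} a b a′ b′ aa′ bb′ = subst (λ q → ℚ.∣ q ∣ ℚ.< ε)
      (solve 4 (λ a b a′ b′ → (a :- a′) :+ (b :- b′) := (a :+ b) :- (a′ :+ b′))
             refl a b a′ b′)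
      (+-small (a ℚ.- a′) (b ℚ.- b′) aa′ bb′)

    neg-close : ∀ {ε} a a′ → ℚ.∣ a ℚ.- a′ ∣ ℚ.< ε → ℚ.∣ (ℚ.- a) ℚ.- (ℚ.- a′) ∣ ℚ.< ε
    neg-close {ε} a a′ aa′ = subst (ℚ._< ε)
      (trans (sym (ℚ.∣-p∣≡∣p∣ (a ℚ.- a′)))
        (cong ℚ.∣_∣ (solve 2 (λ a a′ → :- (a :- a′) := (:- a) :- (:- a′)) refl a a′)))
      aa′

    ∣p-p∣< : ∀ {ε} → 0ℚ ℚ.< ε → ∀ {p q} → p ≡ q → ℚ.∣ p ℚ.- q ∣ ℚ.< ε
    ∣p-p∣< {ε} 0<ε {p} refl =
      subst (λ q → ℚ.∣ q ∣ ℚ.< ε) (sym (ℚ.+-inverseʳ p)) 0<ε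

    ⊔ˡ : ∀ {m} n {o} → m ℕ.⊔ n ℕ.≤ o → m ℕ.≤ o
    ⊔ˡ n = ℕ.m⊔n≤o⇒m≤o _ n

    ⊔ʳ : ∀ m {n o} → m ℕ.⊔ n ℕ.≤ o → n ℕ.≤ o
    ⊔ʳ m = ℕ.m⊔n≤o⇒n≤o m _

  fromℚ : ℚ → ℝ
  fromℚ q = mkℝ (λ _ → q) λ ε 0<ε → 0 , λ _ _ _ _ → ∣p-p∣< 0<ε {q} refl

  fromℤ : ℤ → ℝ
  fromℤ i = fromℚ (i ℚ./ 1)

  infixl 6 _+_
  infixl 7 _*_
  infix  8 -_

  _+_ : ℝ → ℝ → ℝ
  seq    (x + y) n = seq x n ℚ.+ seq y n
  cauchy (x + y) ε 0<ε =
    let M , xs = cauchy x (½ ℚ.* ε) (half 0<ε)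
        N , ys = cauchy y (½ ℚ.* ε) (half 0<ε)
    in M ℕ.⊔ N , λ m n ≤m ≤n →
    +-close (seq x m) (seq y m) (seq x n) (seq y n)
      (xs m n (⊔ˡ N ≤m) (⊔ˡ N ≤n)) (ys m n (⊔ʳ M ≤m) (⊔ʳ M ≤n))

  -_ : ℝ → ℝ
  seq    (- x) n = ℚ.- seq x n
  cauchy (- x) ε 0<ε = let N , xs = cauchy x ε 0<ε in N , λ m n ≤m ≤n → neg-close (seq x m) (seq x n) (xs m n ≤m ≤n)

  _*_ : ℝ → ℝ → ℝ
  seq    (x * y) n = seq x n ℚ.* seq y n
  cauchy (x * y) ε 0<ε =
    let A , 0<A , K , x< = bounded x
        B , 0<B , L , y< = bounded y
        M , xs = cauchy x (tol B 0<B (½ ℚ.* ε)) (tol-pos B 0<B (half 0<ε))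
        N , ys = cauchy y (tol A 0<A (½ ℚ.* ε)) (tol-pos A 0<A (half 0<ε))
    in (K ℕ.⊔ L) ℕ.⊔ (M ℕ.⊔ N) , λ m n ≤m ≤n →
    *-close A 0<A B 0<B (seq x m) (seq y m) (seq x n) (seq y n)
      (x< m (⊔ˡ L (⊔ˡ (M ℕ.⊔ N) ≤m)))
      (y< n (⊔ʳ K (⊔ˡ (M ℕ.⊔ N) ≤n)))
      (ys m n (⊔ʳ M (⊔ʳ (K ℕ.⊔ L) ≤m)) (⊔ʳ M (⊔ʳ (K ℕ.⊔ L) ≤n)))
      (xs m n (⊔ˡ N (⊔ʳ (K ℕ.⊔ L) ≤m)) (⊔ˡ N (⊔ʳ (K ℕ.⊔ L) ≤n)))

  pointwise : ∀ x y → (∀ n → seq x n ≡ seq y n) → x ≈ y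
  pointwise x y eq ε 0<ε = 0 , λ n _ → ∣p-p∣< 0<ε (eq n)

  ≈-isEquivalence : IsEquivalence _≈_
  ≈-isEquivalence = record
    { refl  = λ {x} → pointwise x x (λ _ → refl)
    ; sym   = λ {x} {y} x≈y ε 0<ε → let N , p = x≈y ε 0<ε in N , λ n ≤n →
        subst (ℚ._< ε)
          (trans (sym (ℚ.∣-p∣≡∣p∣ (seq x n ℚ.- seq y n)))
            (cong ℚ.∣_∣ (solve 2 (λ a b → :- (a :- b) := b :- a) refl (seq x n) (seq y n))))
          (p n ≤n)
    ; trans = λ {x} {y} {z} x≈y y≈z ε 0<ε →
        let M , p = x≈y (½ ℚ.* ε) (half 0<ε)
            N , q = y≈z (½ ℚ.* ε) (half 0<ε)
        in M ℕ.⊔ N , λ n ≤n →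
        subst (λ r → ℚ.∣ r ∣ ℚ.< ε)
          (solve 3 (λ a b c → (a :- b) :+ (b :- c) := a :- c) refl (seq x n) (seq y n) (seq z n))
          (+-small (seq x n ℚ.- seq y n) (seq y n ℚ.- seq z n) (p n (⊔ˡ N ≤n)) (q n (⊔ʳ M ≤n)))
    }

  +-cong : ∀ {x x′ y y′} → x ≈ x′ → y ≈ y′ → x + y ≈ x′ + y′
  +-cong {x} {x′} {y} {y′} x≈ y≈ ε 0<ε =
    let M , p = x≈ (½ ℚ.* ε) (half 0<ε)
        N , q = y≈ (½ ℚ.* ε) (half 0<ε)
    in M ℕ.⊔ N , λ n ≤n →
    +-close (seq x n) (seq y n) (seq x′ n) (seq y′ n) (p n (⊔ˡ N ≤n)) (q n (⊔ʳ M ≤n))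

  -‿cong : ∀ {x x′} → x ≈ x′ → - x ≈ - x′
  -‿cong {x} {x′} x≈ ε 0<ε =
    let N , p = x≈ ε 0<ε in N , λ n ≤n → neg-close (seq x n) (seq x′ n) (p n ≤n)

  *-cong : ∀ {x x′ y y′} → x ≈ x′ → y ≈ y′ → x * y ≈ x′ * y′
  *-cong {x} {x′} {y} {y′} x≈ y≈ ε 0<ε =
    let A , 0<A , K , x<  = bounded x
        B , 0<B , L , y′< = bounded y′
        M , p = x≈ (tol B 0<B (½ ℚ.* ε)) (tol-pos B 0<B (half 0<ε))
        N , q = y≈ (tol A 0<A (½ ℚ.* ε)) (tol-pos A 0<A (half 0<ε))
    in (K ℕ.⊔ L) ℕ.⊔ (M ℕ.⊔ N) , λ n ≤n →
    *-close A 0<A B 0<B (seq x n) (seq y n) (seq x′ n) (seq y′ n)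
      (x< n (⊔ˡ L (⊔ˡ (M ℕ.⊔ N) ≤n)))
      (y′< n (⊔ʳ K (⊔ˡ (M ℕ.⊔ N) ≤n)))
      (q n (⊔ʳ M (⊔ʳ (K ℕ.⊔ L) ≤n)))
      (p n (⊔ˡ N (⊔ʳ (K ℕ.⊔ L) ≤n)))

  commutativeRing : CommutativeRing 0ℓ 0ℓ
  commutativeRing = record
    { Carrier = ℝ ; _≈_ = _≈_ ; _+_ = _+_ ; _*_ = _*_ ; -_ = -_
    ; 0# = fromℚ 0ℚ ; 1# = fromℚ 1ℚ
    ; isCommutativeRing = record
      { isRing = record
        { +-isAbelianGroup = record
          { isGroup = record
            { isMonoid = record
              { isSemigroup = record
                { isMagma = record
                  { isEquivalence = ≈-isEquivalence
                  ; ∙-cong = λ {x} {x′} {y} {y′} → +-cong {x} {x′} {y} {y′} }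
                ; assoc = λ x y z → pointwise ((x + y) + z) (x + (y + z))
                    λ n → ℚ.+-assoc (seq x n) (seq y n) (seq z n) }
              ; identity =
                  (λ x → pointwise (fromℚ 0ℚ + x) x λ n → ℚ.+-identityˡ (seq x n))
                , (λ x → pointwise (x + fromℚ 0ℚ) x λ n → ℚ.+-identityʳ (seq x n)) }
            ; inverse =
                (λ x → pointwise (- x + x) (fromℚ 0ℚ) λ n → ℚ.+-inverseˡ (seq x n))
              , (λ x → pointwise (x + - x) (fromℚ 0ℚ) λ n → ℚ.+-inverseʳ (seq x n))
            ; ⁻¹-cong = λ {x} {x′} → -‿cong {x} {x′} }
          ; comm = λ x y → pointwise (x + y) (y + x) λ n → ℚ.+-comm (seq x n) (seq y n) }
        ; *-cong = λ {x} {x′} {y} {y′} → *-cong {x} {x′} {y} {y′}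
        ; *-assoc = λ x y z → pointwise ((x * y) * z) (x * (y * z))
            λ n → ℚ.*-assoc (seq x n) (seq y n) (seq z n)
        ; *-identity =
            (λ x → pointwise (fromℚ 1ℚ * x) x λ n → ℚ.*-identityˡ (seq x n))
          , (λ x → pointwise (x * fromℚ 1ℚ) x λ n → ℚ.*-identityʳ (seq x n))
        ; distrib =
            (λ x y z → pointwise (x * (y + z)) (x * y + x * z)
              λ n → ℚ.*-distribˡ-+ (seq x n) (seq y n) (seq z n))
          , (λ x y z → pointwise ((y + z) * x) (y * x + z * x)
              λ n → ℚ.*-distribʳ-+ (seq x n) (seq y n) (seq z n)) }
      ; *-comm = λ x y → pointwise (x * y) (y * x) λ n → ℚ.*-comm (seq x n) (seq y n) } }

open Reals public using (ℝ; mkℝ; seq; cauchy; fromℤ)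

-- Boolean membership makes the families decidable and makes `_∈ᶠ_`
-- proof-irrelevant, so that equality in `El S` is equality of subsets.
Family : ℕ → Set
Family n = Subset n → Bool

infix 4 _∈ᶠ_ _⊆ᶠ_

_∈ᶠ_ : ∀ {n} → Subset n → Family n → Set
s ∈ᶠ S = T (S s)

_⊆ᶠ_ : ∀ {n} → Family n → Family n → Set
S ⊆ᶠ S′ = ∀ {s} → s ∈ᶠ S → s ∈ᶠ S′

_∖_ : ∀ {n} → Family n → Family n → Family n
(S ∖ S′) s = S s ∧ not (S′ s)

El : ∀ {n} → Family n → Set
El {n} S = Σ[ s ∈ Subset n ] s ∈ᶠ S

-- Every subset of Fin n, exactly once.
subsets : ∀ n → List (Subset n)
subsets zero    = [] List.∷ List.[]
subsets (suc n) = List.map (outside ∷_) (subsets n) ++ List.map (inside ∷_) (subsets n)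

-- Every element of El S, exactly once.
elements : ∀ {n} (S : Family n) → List (El S)
elements {n} S = List.mapMaybe (λ s → Maybe.map (s ,_) (dec⇒maybe (T? (S s)))) (subsets n)

∑ : ∀ {n} (M : CommutativeMonoid 0ℓ 0ℓ) (S : Family n) →
    (El S → CommutativeMonoid.Carrier M) → CommutativeMonoid.Carrier M
∑ M S f = Sum.sum M (λ i → f (List.lookup (elements S) i))

record SimplicialComplex (n : ℕ) : Set where
  field
    face     : Family n
    nonempty : ∃[ s ] s ∈ᶠ face
    closed   : ∀ {s t} → s ⊆ t → t ∈ᶠ face → s ∈ᶠ face

open SimplicialComplex public

-- Graded by cardinality rather than by dimension, which starts at −1:
-- the k-faces of G are G ⟨ suc k ⟩ and the (k−1)-faces are G ⟨ k ⟩.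
_⟨_⟩ : ∀ {n} → SimplicialComplex n → ℕ → Family n
(G ⟨ c ⟩) s = face G s ∧ (∣ s ∣ ℕ.≡ᵇ c)

HasDimension : ∀ {n} → SimplicialComplex n → ℕ → Set
HasDimension G d =
  (∃[ s ] s ∈ᶠ face G × ∣ s ∣ ≡ suc d) × (∀ s → s ∈ᶠ face G → ∣ s ∣ ℕ.≤ suc d)

-- The number of elements of f smaller than v, i.e. the j with v = vⱼ
-- when v ∈ f = {v₀ < ⋯ < vₖ}.
position : ∀ {n} → Subset n → Fin n → ℕ
position (_       ∷ f) zero    = 0
position (outside ∷ f) (suc v) = position f v
position (inside  ∷ f) (suc v) = suc (position f v)

-- The entry ∂[ r , f ] of the incidence matrix.
∂[_,_] : ∀ {n} → Subset n → Subset n → ℤ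
∂[ r , f ] with any? (λ v → (v ∈? f) ×-dec (≡-dec Bool._≟_ r (f - v)))
... | yes (v , _) = -1ℤ ℤ.^ position f v
... | no  _       = 0ℤ

module _ where
  open CommutativeRing Reals.commutativeRing

  module _ {n} (S : Family n) {J : Set} where

    ℝ-combination : (El S → ℝ) → (El S → J → ℝ) → J → ℝ
    ℝ-combination c v j = ∑ +-commutativeMonoid S (λ s → c s * v s j)

    LinearlyIndependent : (El S → J → ℝ) → Set
    LinearlyIndependent v =
      ∀ c → (∀ j → ℝ-combination c v j ≈ 0#) → ∀ s → c s ≈ 0#

    Span : (El S → J → ℝ) → Pred (J → ℝ) 0ℓ
    Span v w = ∃[ c ] (∀ j → w j ≈ ℝ-combination c v j)

    IsBasisOf : (El S → J → ℝ) → Pred (J → ℝ) 0ℓ → Set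
    IsBasisOf v W =
      (∀ s → W (v s)) × LinearlyIndependent v × (∀ w → W w → Span v w)

module _ {n} (G : SimplicialComplex n) (d : ℕ) where

  complement : Family n → Family n
  complement R = (G ⟨ d ⟩) ∖ R

  columns : (F : Family n) → El F → El (G ⟨ d ⟩) → ℝ
  columns F f r = fromℤ ∂[ proj₁ r , proj₁ f ]

  IsForest : Family n → Set
  IsForest F = F ⊆ᶠ G ⟨ suc d ⟩ ×
    LinearlyIndependent F (columns F)

  -- The rows, indexed by S, of the incidence matrix with columns F.
  rows : (F S : Family n) → El S → El F → ℝ
  rows F S r f = fromℤ ∂[ proj₁ r , proj₁ f ]

  RowSpace : (F : Family n) → Pred (El F → ℝ) 0ℓ
  RowSpace F = Span (G ⟨ d ⟩) (rows F (G ⟨ d ⟩))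

  IsRoot : (F R : Family n) → Set
  IsRoot F R = R ⊆ᶠ G ⟨ d ⟩ × IsBasisOf (complement R) (rows F (complement R)) (RowSpace F)

  IsRootedForest : (F R : Family n) → Set
  IsRootedForest F R = IsForest F × IsRoot F R

Hom : (A B : AbelianGroup 0ℓ 0ℓ) → Set
Hom A B = GroupHomomorphism (AbelianGroup.rawGroup A) (AbelianGroup.rawGroup B)

module _ (A B : AbelianGroup 0ℓ 0ℓ) where
  private
    module A = AbelianGroup A
    module B = AbelianGroup B
    open AbelianGroupProperties B
    open CommutativeSemigroupProperties B.commutativeSemigroup using (interchange)

  mkHom : (f : A.Carrier → B.Carrier) →
          (∀ {x y} → x A.≈ y → f x B.≈ f y) →
          (∀ x y → f (x A.∙ y) B.≈ f x B.∙ f y) → Hom A B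
  mkHom f f-cong f-homo = record
    { ⟦_⟧ = f
    ; isGroupHomomorphism = record
      { isMonoidHomomorphism = record
        { isMagmaHomomorphism = record
          { isRelHomomorphism = record { cong = f-cong }
          ; homo = f-homo }
        ; ε-homo = ε-homo }
      ; ⁻¹-homo = λ x → inverseˡ-unique (f (x A.⁻¹)) (f x)
          (B.trans (B.sym (f-homo (x A.⁻¹) x)) (B.trans (f-cong (A.inverseˡ x)) ε-homo)) } }
    where
    ε-homo : f A.ε B.≈ B.ε
    ε-homo = identityˡ-unique (f A.ε) (f A.ε)
      (B.trans (B.sym (f-homo A.ε A.ε)) (f-cong (A.identityˡ A.ε)))

  coker : Hom A B → AbelianGroup 0ℓ 0ℓ
  coker h = record
    { Carrier = B.Carrier
    ; _≈_ = _≋_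
    ; _∙_ = B._∙_ ; ε = B.ε ; _⁻¹ = B._⁻¹
    ; isAbelianGroup = record
      { isGroup = record
        { isMonoid = record
          { isSemigroup = record
            { isMagma = record
              { isEquivalence = record
                { refl  = lift B.refl
                ; sym   = ≋-sym
                ; trans = ≋-trans }
              ; ∙-cong = ≋-∙-cong }
            ; assoc = λ x y z → lift (B.assoc x y z) }
          ; identity = (λ x → lift (B.identityˡ x)) , (λ x → lift (B.identityʳ x)) }
        ; inverse = (λ x → lift (B.inverseˡ x)) , (λ x → lift (B.inverseʳ x))
        ; ⁻¹-cong = ≋-⁻¹-cong }
      ; comm = λ x y → lift (B.comm x y) } }
    where
    open GroupHomomorphism h
    open SetoidReasoning B.setoid

    _≋_ : B.Carrier → B.Carrier → Set
    x ≋ y = ∃[ a ] x B.≈ y B.∙ ⟦ a ⟧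

    lift : ∀ {x y} → x B.≈ y → x ≋ y
    lift {x} {y} x≈y = A.ε , (begin
      x                  ≈⟨ x≈y ⟩
      y                  ≈⟨ B.identityʳ y ⟨
      y B.∙ B.ε          ≈⟨ B.∙-congˡ ε-homo ⟨
      y B.∙ ⟦ A.ε ⟧      ∎)

    ≋-sym : ∀ {x y} → x ≋ y → y ≋ x
    ≋-sym {x} {y} (a , x≈) = a A.⁻¹ , (begin
      y                                ≈⟨ B.identityʳ y ⟨
      y B.∙ B.ε                        ≈⟨ B.∙-congˡ (B.inverseʳ ⟦ a ⟧) ⟨
      y B.∙ (⟦ a ⟧ B.∙ ⟦ a ⟧ B.⁻¹)     ≈⟨ B.assoc y ⟦ a ⟧ (⟦ a ⟧ B.⁻¹) ⟨
      (y B.∙ ⟦ a ⟧) B.∙ ⟦ a ⟧ B.⁻¹     ≈⟨ B.∙-cong x≈ (⁻¹-homo a) ⟨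
      x B.∙ ⟦ a A.⁻¹ ⟧                 ∎)

    ≋-trans : ∀ {x y z} → x ≋ y → y ≋ z → x ≋ z
    ≋-trans {x} {y} {z} (a , x≈) (b , y≈) = b A.∙ a , (begin
      x                              ≈⟨ x≈ ⟩
      y B.∙ ⟦ a ⟧                    ≈⟨ B.∙-congʳ y≈ ⟩
      (z B.∙ ⟦ b ⟧) B.∙ ⟦ a ⟧        ≈⟨ B.assoc z ⟦ b ⟧ ⟦ a ⟧ ⟩
      z B.∙ (⟦ b ⟧ B.∙ ⟦ a ⟧)        ≈⟨ B.∙-congˡ (homo b a) ⟨
      z B.∙ ⟦ b A.∙ a ⟧              ∎)

    ≋-∙-cong : ∀ {x x′ y y′} → x ≋ x′ → y ≋ y′ → (x B.∙ y) ≋ (x′ B.∙ y′)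
    ≋-∙-cong {x} {x′} {y} {y′} (a , x≈) (b , y≈) = a A.∙ b , (begin
      x B.∙ y                                  ≈⟨ B.∙-cong x≈ y≈ ⟩
      (x′ B.∙ ⟦ a ⟧) B.∙ (y′ B.∙ ⟦ b ⟧)        ≈⟨ interchange x′ ⟦ a ⟧ y′ ⟦ b ⟧ ⟩
      (x′ B.∙ y′) B.∙ (⟦ a ⟧ B.∙ ⟦ b ⟧)        ≈⟨ B.∙-congˡ (homo a b) ⟨
      (x′ B.∙ y′) B.∙ ⟦ a A.∙ b ⟧              ∎)

    ≋-⁻¹-cong : ∀ {x x′} → x ≋ x′ → (x B.⁻¹) ≋ (x′ B.⁻¹)
    ≋-⁻¹-cong {x} {x′} (a , x≈) = a A.⁻¹ , (begin
      x B.⁻¹                       ≈⟨ B.⁻¹-cong x≈ ⟩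
      (x′ B.∙ ⟦ a ⟧) B.⁻¹          ≈⟨ ⁻¹-∙-comm x′ ⟦ a ⟧ ⟨
      x′ B.⁻¹ B.∙ ⟦ a ⟧ B.⁻¹       ≈⟨ B.∙-congˡ (⁻¹-homo a) ⟨
      x′ B.⁻¹ B.∙ ⟦ a A.⁻¹ ⟧       ∎)

  toCoker : (h : Hom A B) → GroupHomomorphism B.rawGroup (AbelianGroup.rawGroup (coker h))
  toCoker h = record
    { ⟦_⟧ = λ x → x
    ; isGroupHomomorphism = record
      { isMonoidHomomorphism = record
        { isMagmaHomomorphism = record
          { isRelHomomorphism = record { cong = lift }
          ; homo = λ x y → C.refl {x B.∙ y} }
        ; ε-homo = C.refl {B.ε} }
      ; ⁻¹-homo = λ x → C.refl {x B.⁻¹} } }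
    where
    module C = AbelianGroup (coker h)
    lift : ∀ {x y} → x B.≈ y → x C.≈ y
    lift {x} {y} x≈y = A.ε , B.trans x≈y
      (B.trans (B.sym (B.identityʳ y)) (B.∙-congˡ (B.sym (GroupHomomorphism.ε-homo h))))

ℤ[_] : ∀ {n} → Family n → AbelianGroup 0ℓ 0ℓ
ℤ[ S ] = Pointwise.abelianGroup (El S) ℤ.+-0-abelianGroup

boundary : ∀ {n} (S S′ : Family n) → Hom ℤ[ S ] ℤ[ S′ ]
boundary S S′ = mkHom ℤ[ S ] ℤ[ S′ ]
  (λ z r → ∑ ℤ.+-0-commutativeMonoid S (λ f → ∂[ proj₁ r , proj₁ f ] ℤ.* z f))
  (λ z≈ r → sum-cong-≗ λ i →
    cong (∂[ proj₁ r , proj₁ (el i) ] ℤ.*_) (z≈ (el i)))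
  (λ z z′ r → trans
    (sum-cong-≗ λ i → ℤ.*-distribˡ-+ ∂[ proj₁ r , proj₁ (el i) ] (z (el i)) (z′ (el i)))
    (∑-distrib-+ (λ i → ∂[ proj₁ r , proj₁ (el i) ] ℤ.* z  (el i))
                 (λ i → ∂[ proj₁ r , proj₁ (el i) ] ℤ.* z′ (el i))))
  where
  open Sum ℤ.+-0-commutativeMonoid
  el = List.lookup (elements S)

extendByZero : ∀ {n} (S : Family n) → (El S → ℤ) → Subset n → ℤ
extendByZero S z s with T? (S s)
... | yes s∈S = z (s , s∈S)
... | no  _   = 0ℤ

-- The inclusion of ℤS in ℤS′; intended for S ⊆ᶠ S′.
inclusion : ∀ {n} (S S′ : Family n) → Hom ℤ[ S ] ℤ[ S′ ]
inclusion S S′ = mkHom ℤ[ S ] ℤ[ S′ ]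
  (λ z s → extendByZero S z (proj₁ s))
  (λ z≈ s → ext-cong z≈ (proj₁ s))
  (λ z z′ s → ext-+ z z′ (proj₁ s))
  where
  ext-cong : ∀ {z z′} → (∀ s → z s ≡ z′ s) → ∀ s → extendByZero S z s ≡ extendByZero S z′ s
  ext-cong z≈ s with T? (S s)
  ... | yes s∈S = z≈ (s , s∈S)
  ... | no  _   = refl

  ext-+ : ∀ z z′ s → extendByZero S (λ t → z t ℤ.+ z′ t) s ≡
                     extendByZero S z s ℤ.+ extendByZero S z′ s
  ext-+ z z′ s with T? (S s)
  ... | yes _ = refl
  ... | no  _ = refl

module _ {n} (G : SimplicialComplex n) (d : ℕ) (F R : Family n) where

  ℤGd-1/ℤR : AbelianGroup 0ℓ 0ℓ
  ℤGd-1/ℤR = coker ℤ[ R ] ℤ[ G ⟨ d ⟩ ] (inclusion R (G ⟨ d ⟩))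

  Ψ : Hom ℤ[ F ] ℤGd-1/ℤR
  Ψ = Composition.groupHomomorphism
        {M₁ = AbelianGroup.group ℤ[ F ]}
        {M₂ = AbelianGroup.group ℤ[ G ⟨ d ⟩ ]}
        {M₃ = AbelianGroup.group ℤGd-1/ℤR}
        (boundary F (G ⟨ d ⟩)) (toCoker ℤ[ R ] ℤ[ G ⟨ d ⟩ ] (inclusion R (G ⟨ d ⟩)))

  RelativeHomology : AbelianGroup 0ℓ 0ℓ
  RelativeHomology = coker ℤ[ F ] ℤGd-1/ℤR Ψ

  record FittingOrientation : Set where
    field
      orient : El (complement G d R) ⤖ El F
      fits   : ∀ r → proj₁ r ⊂ proj₁ (Bijection.to orient r)

  fittingOrientations : Setoid 0ℓ 0ℓ
  fittingOrientations = record
    { Carrier = FittingOrientation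
    ; _≈_ = λ φ ψ → ∀ r → Bijection.to (FittingOrientation.orient φ) r ≡ Bijection.to (FittingOrientation.orient ψ) r
    ; isEquivalence = record
      { refl  = λ _ → refl
      ; sym   = λ φ≈ψ r → sym (φ≈ψ r)
      ; trans = λ φ≈ψ ψ≈χ r → trans (φ≈ψ r) (ψ≈χ r) } }

open FittingOrientation public

HasCardinality : Setoid 0ℓ 0ℓ → ℕ → Set
HasCardinality S m = Inverse (setoid (Fin m)) S

module Submission where

-- Independence over ℝ makes the integer matrix A of ∂ with rows R̄ and columns F square and injective,
-- and the relative homology is its cokernel. The order of the cokernel is ∣det A∣, a sum over the
-- bijections R̄ → F of products of entries of A up to sign; every nonzero product is ±1 and comes from a
-- fitting orientation. Determinants are avoided: for fixed columns c₂, …, cₙ there is a linear functional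
-- δ such that coker [v c₂ … cₙ] has order ∣δ v∣ (with δ v = 0 exactly when the matrix is singular), which
-- is seen by bringing the columns to triangular form by automorphisms of ℤⁿ. Then ∣δ v∣ ≤ Σ ∣vᵢ∣ ∣δ eᵢ∣,
-- and ∣δ eᵢ∣ is the order of the cokernel of a minor.

open import Defs
open import Algebra.Bundles using (AbelianGroup; CommutativeRing)
open import Algebra.Morphism.Bundles using (GroupHomomorphism)
import Algebra.Properties.CommutativeMonoid.Sum as Sum
import Algebra.Properties.CommutativeSemigroup as CommutativeSemigroupProperties
import Algebra.Properties.Semiring.Sum as SemiringSum
open import Data.Bool.Base using (Bool; true; false; if_then_else_; T)
import Data.Bool.Properties as Bool
open import Data.Fin.Base
  using (Fin; zero; suc; fromℕ<; toℕ; combine; remQuot; punchIn; punchOut; splitAt; _↑ˡ_; _↑ʳ_; inject≤)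
open import Data.Fin.Permutation
  using (Permutation; _⟨$⟩ʳ_; _⟨$⟩ˡ_; inverseˡ; inverseʳ; transpose; insert; remove; insert-punchIn)
import Data.Fin.Permutation as Perm
import Data.Fin.Properties as Fin
open import Data.Fin.Subset as Subset using (Subset; inside; outside; _⊂_)
open import Data.Fin.Subset.Properties using (_⊂?_; _∈?_; x∈p⇒p-x⊂p)
open import Data.Integer.Base as ℤ using (ℤ; 0ℤ; 1ℤ; -1ℤ; +_; ∣_∣; _+_; _*_; _-_; -_)
open import Data.Integer.DivMod using (_/_; _%_; n%d<d; a≡a%n+[a/n]*n)
import Data.Integer.Properties as ℤ
open import Data.Integer.Tactic.RingSolver using (solve-∀; solve)
open import Data.List.Base as List using (List; []; _∷_; length; lookup; mapMaybe)
open import Data.List.Membership.Propositional using (_∈_)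
open import Data.List.Membership.Propositional.Properties
  using (∈-lookup; ∈-map⁺; ∈-map⁻; ∈-++⁺ˡ; ∈-++⁺ʳ)
import Data.List.Relation.Unary.All as All
open import Data.List.Relation.Unary.AllPairs using ([]; _∷_)
open import Data.List.Relation.Unary.Any as Any using (here; there)
import Data.List.Relation.Unary.Any.Properties as Any
open import Data.List.Relation.Unary.Unique.Propositional using (Unique)
import Data.List.Relation.Unary.Unique.Propositional.Properties as Unique
import Data.Maybe.Base as Maybe
open import Data.Nat.Base as ℕ using (ℕ; zero; suc; _≥_)
open import Data.Nat.Coprimality using (1-coprimeTo) renaming (sym to coprime-sym)
import Data.Nat.Induction as ℕ
import Data.Nat.Properties as ℕ
open import Data.Product.Base using (Σ; Σ-syntax; ∃-syntax; ∃₂; _×_; _,_; proj₁; proj₂)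
open import Data.Rational.Base as ℚ using (mkℚ; 1ℚ; *<*)
import Data.Rational.Properties as ℚ
open import Data.Sum.Base using (_⊎_; inj₁; inj₂; [_,_])
open import Data.Unit.Base using (tt)
import Data.Vec.Base as Vec
open import Data.Vec.Functional using (head; tail) renaming (_∷_ to _◂_)
import Data.Vec.Properties as Vec
open import Function.Base using (_∘_)
open import Function.Bundles using (Inverse; Bijection; _↔_; mk↔ₛ′)
open import Function.Construct.Composition using (_↔-∘_; inverse)
open import Function.Construct.Symmetry using (↔-sym)
open import Function.Properties.Bijection using (⤖⇒↔)
open import Function.Properties.Inverse using (↔⇒⤖)
open import Induction.WellFounded using (Acc; acc)
open import Level using (0ℓ)
open import Relation.Binary.Bundles using (Setoid)
open import Relation.Binary.PropositionalEquality
  using (_≡_; _≢_; _≗_; refl; sym; trans; cong; cong₂; subst; setoid; module ≡-Reasoning)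
import Relation.Binary.Reasoning.Setoid as SetoidReasoning
open import Relation.Nullary.Decidable
  using (yes; no; does; ⌊_⌋; T?; ¬?; _×-dec_; dec⇒maybe; toWitness; fromWitness; decidable-stable)
open import Relation.Nullary.Negation using (¬_; contradiction)

open import Algebra.Properties.AbelianGroup ℤ.+-0-abelianGroup using (∙-cancelˡ)
open CommutativeSemigroupProperties ℤ.+-commutativeSemigroup using (interchange)
open CommutativeSemigroupProperties ℤ.*-commutativeSemigroup using (x∙yz≈y∙xz)
open ≡-Reasoning

-- Equality of reals given by Cauchy sequences cannot be decided, so elimination over ℝ is out of
-- reach. Independence is therefore tested only on integer coefficients, and the determinant
-- argument stays over ℤ, where equality is decidable and Euclid's algorithm is available. The order
-- of a cokernel is not additive in a column, so it cannot be estimated column entry by column entry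
-- directly. What the triangle inequality needs is one functional `δ`, chosen before the column `v`,
-- that gives the order for all `v` at once. Signs are never tracked: a cokernel sees only the
-- absolute value of a determinant, and the estimate asks for nothing more. The existence claim
-- comes from the inequality, since a cokernel always contains its zero class.

private
  module ℕΣ = Sum ℕ.+-0-commutativeMonoid
  module ℤΣ = Sum ℤ.+-0-commutativeMonoid

-- Integer linear functionals and matrices given by their rows.

ℤ^ : ℕ → Set
ℤ^ n = Fin n → ℤ

𝟎 : ∀ {n} → ℤ^ n
𝟎 _ = 0ℤ

-- A linear form is kept as a function with its laws, not as a coefficient vector, so that composing
-- matrices is composing functions and involves no sums. Vectors are functions compared pointwise,
-- hence the field `respects`.
record Functional (n : ℕ) : Set where
  field
    apply       : ℤ^ n → ℤ
    respects    : ∀ {x y} → x ≗ y → apply x ≡ apply y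
    additive    : ∀ x y → apply (λ i → x i + y i) ≡ apply x + apply y
    homogeneous : ∀ a x → apply (λ i → a * x i) ≡ a * apply x

  apply-zero : ∀ {x} → x ≗ 𝟎 → apply x ≡ 0ℤ
  apply-zero {x} x≗𝟎 = trans (respects x≗𝟎) (homogeneous 0ℤ 𝟎)

  apply-minus : ∀ x y → apply (λ i → x i - y i) ≡ apply x - apply y
  apply-minus x y = begin
    apply (λ i → x i - y i)           ≡⟨ respects (λ i → cong (_+_ (x i)) (sym (ℤ.-1*i≡-i (y i)))) ⟩
    apply (λ i → x i + -1ℤ * y i)     ≡⟨ additive x _ ⟩
    apply x + apply (λ i → -1ℤ * y i) ≡⟨ cong (_+_ (apply x)) (trans (homogeneous -1ℤ y) (ℤ.-1*i≡-i _)) ⟩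
    apply x - apply y                 ∎

open Functional

infix 4 _⊸_
_⊸_ : ℕ → ℕ → Set
m ⊸ n = Fin n → Functional m

infixr 9 _·_
_·_ : ∀ {m n} → m ⊸ n → ℤ^ m → ℤ^ n
(f · x) j = apply (f j) x

coordinate : ∀ {n} → Fin n → Functional n
coordinate i = record
  { apply = λ x → x i ; respects = λ x≗y → x≗y i
  ; additive = λ _ _ → refl ; homogeneous = λ _ _ → refl }

infixr 9 _∘ᶠ_ _⊚_
_∘ᶠ_ : ∀ {m n} → Functional n → m ⊸ n → Functional m
g ∘ᶠ f = record
  { apply = λ x → apply g (f · x)
  ; respects = λ x≗y → respects g (λ j → respects (f j) x≗y)
  ; additive = λ x y → trans (respects g (λ j → additive (f j) x y)) (additive g (f · x) (f · y))
  ; homogeneous = λ a x → trans (respects g (λ j → homogeneous (f j) a x)) (homogeneous g a (f · x)) }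

_⊚_ : ∀ {l m n} → m ⊸ n → l ⊸ m → l ⊸ n
(g ⊚ f) k = g k ∘ᶠ f

infixl 6 _+ᶠ_
infixr 7 _*ᶠ_
_+ᶠ_ : ∀ {n} → Functional n → Functional n → Functional n
g +ᶠ h = record
  { apply = λ x → apply g x + apply h x
  ; respects = λ x≗y → cong₂ _+_ (respects g x≗y) (respects h x≗y)
  ; additive = λ x y → trans (cong₂ _+_ (additive g x y) (additive h x y))
      (interchange (apply g x) (apply g y) (apply h x) (apply h y))
  ; homogeneous = λ a x → trans (cong₂ _+_ (homogeneous g a x) (homogeneous h a x))
      (sym (ℤ.*-distribˡ-+ a (apply g x) (apply h x))) }

_*ᶠ_ : ∀ {n} → ℤ → Functional n → Functional n
a *ᶠ g = record
  { apply = λ x → a * apply g x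
  ; respects = λ x≗y → cong (a *_) (respects g x≗y)
  ; additive = λ x y → trans (cong (a *_) (additive g x y)) (ℤ.*-distribˡ-+ a (apply g x) (apply g y))
  ; homogeneous = λ b x → trans (cong (a *_) (homogeneous g b x)) (x∙yz≈y∙xz a b (apply g x)) }

extend : ∀ {n} → ℤ → Functional n → Functional (suc n)
extend a g = a *ᶠ coordinate zero +ᶠ g ∘ᶠ (coordinate ∘ suc)

null : ∀ {n} → Functional n
null = record
  { apply = λ _ → 0ℤ ; respects = λ _ → refl
  ; additive = λ _ _ → refl ; homogeneous = λ a _ → sym (ℤ.*-zeroʳ a) }

shift : ∀ {n} → n ⊸ suc n
shift zero    = null
shift (suc j) = coordinate j

-- The matrix with first column v followed by the columns of f.
adjoin : ∀ {m n} → ℤ^ n → m ⊸ n → suc m ⊸ n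
adjoin v f j = extend (v j) (f j)

-- The block matrix with rows (g , s) and (0 , f).
block : ∀ {m n} → ℤ → Functional m → m ⊸ n → suc m ⊸ suc n
block g s f zero    = extend g s
block g s f (suc j) = f j ∘ᶠ (coordinate ∘ suc)

basis : ∀ {n} → Fin n → ℤ^ n
basis zero    = 1ℤ ◂ 𝟎
basis (suc i) = 0ℤ ◂ basis i

firstColumn : ∀ {m n} → suc m ⊸ n → ℤ^ n
firstColumn f = f · basis zero

otherColumns : ∀ {m n} → suc m ⊸ n → m ⊸ n
otherColumns f = f ⊚ shift

expand : ∀ {m} (g : Functional (suc m)) x →
         apply g x ≡ apply g (basis zero) * x zero + apply (g ∘ᶠ shift) (tail x)
expand g x = begin
  apply g x
    ≡⟨ respects g (λ { zero → split₀ (x zero) ; (suc i) → split₁ (x zero) (x (suc i)) }) ⟩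
  apply g (λ i → x zero * basis zero i + (shift · tail x) i)
    ≡⟨ additive g _ _ ⟩
  apply g (λ i → x zero * basis zero i) + apply g (shift · tail x)
    ≡⟨ cong (_+ apply g (shift · tail x)) (trans (homogeneous g (x zero) (basis zero)) (ℤ.*-comm (x zero) _)) ⟩
  apply g (basis zero) * x zero + apply g (shift · tail x) ∎
  where
  split₀ : ∀ a → a ≡ a * 1ℤ + 0ℤ
  split₀ = solve-∀
  split₁ : ∀ a b → b ≡ a * 0ℤ + b
  split₁ = solve-∀

-- Automorphisms of ℤⁿ and Euclidean reduction of a vector.

record Automorphism (n : ℕ) : Set where
  field
    to from  : n ⊸ n
    to∘from  : ∀ x → to · from · x ≗ x
    from∘to  : ∀ x → from · to · x ≗ x

open Automorphism

identity : ∀ {n} → Automorphism n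
identity = record
  { to = coordinate ; from = coordinate ; to∘from = λ _ _ → refl ; from∘to = λ _ _ → refl }

infixr 9 _⊙_
_⊙_ : ∀ {n} → Automorphism n → Automorphism n → Automorphism n
U ⊙ V = record
  { to = to U ⊚ to V ; from = from V ⊚ from U
  ; to∘from = λ x j → trans (respects (to U j) (to∘from V (from U · x))) (to∘from U x j)
  ; from∘to = λ x j → trans (respects (from V j) (from∘to U (to V · x))) (from∘to V x j) }

permute : ∀ {n} → Permutation n n → Automorphism n
permute π = record
  { to = λ j → coordinate (π ⟨$⟩ʳ j) ; from = λ j → coordinate (π ⟨$⟩ˡ j)
  ; to∘from = λ x j → cong x (inverseˡ π) ; from∘to = λ x j → cong x (inverseʳ π) }

-- One step of Euclid's algorithm on the first two coordinates, (a , b) ↦ (b , a - q b). It is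
-- invertible whatever `q` is; the quotient is put in by `reduce₂`.
euclid : ∀ {n} → ℤ → Automorphism (2 ℕ.+ n)
euclid {n} q = record
  { to = to′ ; from = from′
  ; to∘from = λ { x zero → refl ; x (suc zero) → cancel q (x zero) (x (suc zero))
                ; x (suc (suc j)) → refl }
  ; from∘to = λ { x zero → cancel′ q (x zero) (x (suc zero)) ; x (suc zero) → refl
                ; x (suc (suc j)) → refl } }
  where
  to′ from′ : 2 ℕ.+ n ⊸ 2 ℕ.+ n
  to′ zero          = coordinate (suc zero)
  to′ (suc zero)    = coordinate zero +ᶠ - q *ᶠ coordinate (suc zero)
  to′ (suc (suc j)) = coordinate (suc (suc j))
  from′ zero          = coordinate (suc zero) +ᶠ q *ᶠ coordinate zero
  from′ (suc zero)    = coordinate zero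
  from′ (suc (suc j)) = coordinate (suc (suc j))
  cancel : ∀ q a b → (b + q * a) + - q * a ≡ b
  cancel = solve-∀
  cancel′ : ∀ q a b → (a + - q * b) + q * b ≡ a
  cancel′ = solve-∀

liftTail : ∀ {n} → Automorphism n → Automorphism (suc n)
liftTail U = record
  { to = λ { zero → coordinate zero ; (suc j) → to U j ∘ᶠ (coordinate ∘ suc) }
  ; from = λ { zero → coordinate zero ; (suc j) → from U j ∘ᶠ (coordinate ∘ suc) }
  ; to∘from = λ { x zero → refl ; x (suc j) → to∘from U (tail x) j }
  ; from∘to = λ { x zero → refl ; x (suc j) → from∘to U (tail x) j } }

-- The recursion is on ∣b∣, since the remainder `a % b` is a natural number below it. The vector is
-- a variable `x` because an automorphism yields the next pair only up to pointwise equality.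
reduce₂ : ∀ {n} a b → Acc ℕ._<_ ∣ b ∣ → ∀ (x : ℤ^ (2 ℕ.+ n)) → x ≗ a ◂ b ◂ 𝟎 →
          ∃[ g ] Σ[ U ∈ Automorphism (2 ℕ.+ n) ] to U · x ≗ g ◂ 𝟎
reduce₂ {n} a b (acc smaller) x x≗ with b ℤ.≟ 0ℤ
... | yes refl = a , identity , λ
      { zero → x≗ zero ; (suc zero) → x≗ (suc zero) ; (suc (suc j)) → x≗ (suc (suc j)) }
... | no b≢0 =
      let g , U , Ux≗ = reduce₂ b (+ (a % b)) (smaller (n%d<d a b)) (to (euclid (a / b)) · x) step
      in g , U ⊙ euclid (a / b) , Ux≗
  where
  instance _ = ℤ.≢-nonZero b≢0
  cancel : ∀ r t → (r + t) - t ≡ r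
  cancel = solve-∀
  step : to (euclid (a / b)) · x ≗ b ◂ + (a % b) ◂ 𝟎
  step zero          = x≗ (suc zero)
  step (suc zero)    = begin
    x zero + - (a / b) * x (suc zero)        ≡⟨ cong₂ (λ s t → s + - (a / b) * t) (x≗ zero) (x≗ (suc zero)) ⟩
    a + - (a / b) * b                        ≡⟨ cong₂ _+_ (a≡a%n+[a/n]*n a b) (sym (ℤ.neg-distribˡ-* (a / b) b)) ⟩
    (+ (a % b) + (a / b) * b) - (a / b) * b  ≡⟨ cancel (+ (a % b)) ((a / b) * b) ⟩
    + (a % b)                                ∎
  step (suc (suc j)) = x≗ (suc (suc j))

-- Once the tail is reduced, at most two entries are nonzero and they stand first, which is the case
-- of `reduce₂`. The resulting `g` is the gcd of the entries up to sign.
reduce : ∀ {n} (x : ℤ^ (suc n)) → ∃[ g ] Σ[ U ∈ Automorphism (suc n) ] to U · x ≗ g ◂ 𝟎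
reduce {zero}  x = x zero , identity , λ { zero → refl }
reduce {suc n} x =
  let h , V , Vx≗ = reduce (tail x)
      g , U , Ux≗ = reduce₂ (x zero) h (ℕ.<-wellFounded _) (to (liftTail V) · x)
        λ { zero → refl ; (suc zero) → Vx≗ zero ; (suc (suc j)) → Vx≗ (suc j) }
  in g , U ⊙ liftTail V , Ux≗

-- Kernels and cokernels up to changes of basis.

Congruent : ∀ {m n} → m ⊸ n → ℤ^ n → ℤ^ n → Set
Congruent f x y = ∃[ w ] (∀ j → x j ≡ y j + apply (f j) w)

≗⇒Congruent : ∀ {m n} (f : m ⊸ n) {x y} → x ≗ y → Congruent f x y
≗⇒Congruent f {x} {y} x≗y = 𝟎 , λ j → trans (x≗y j)
  (trans (sym (ℤ.+-identityʳ (y j))) (cong (_+_ (y j)) (sym (apply-zero (f j) λ _ → refl))))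

-- The cokernel is enumerated by `Fin d` without forming a quotient: `class` is the projection,
-- `rep` a section. Injectivity is included because it makes the preimage of a congruence unique, on
-- which `Index-block` relies.
record Index {m n} (f : m ⊸ n) (d : ℕ) : Set where
  field
    injective : ∀ w → f · w ≗ 𝟎 → w ≗ 𝟎
    class     : ℤ^ n → Fin d
    rep       : Fin d → ℤ^ n
    class-rep : ∀ k → class (rep k) ≡ k
    sound     : ∀ {x y} → Congruent f x y → class x ≡ class y
    complete  : ∀ {x y} → class x ≡ class y → Congruent f x y

open Index

Kernel : ∀ {m n} → m ⊸ n → Set
Kernel f = ∃[ w ] f · w ≗ 𝟎 × ∃[ i ] w i ≢ 0ℤ

-- z is the determinant of f up to sign, characterised by the cokernel instead of by an expansion.
HasDet : ∀ {m n} → m ⊸ n → ℤ → Set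
HasDet f z = (z ≡ 0ℤ × Kernel f) ⊎ (z ≢ 0ℤ × Index f ∣ z ∣)

-- Equivalence under unimodular row and column operations. These can change a determinant only by a
-- sign, so `HasDet` does not notice them.
record _≅_ {m n} (f f′ : m ⊸ n) : Set where
  field
    target    : Automorphism n
    source    : Automorphism m
    intertwine : ∀ w → to target · f · w ≗ f′ · to source · w

module _ {m n} {f f′ : m ⊸ n} (f≅f′ : f ≅ f′) where
  open _≅_ f≅f′ renaming (target to U; source to P)

  private
    detarget : ∀ {x} → to U · x ≗ 𝟎 → x ≗ 𝟎
    detarget {x} Ux≗ j = trans (sym (from∘to U x j)) (apply-zero (from U j) Ux≗)

    desource : ∀ {x} → to P · x ≗ 𝟎 → x ≗ 𝟎
    desource {x} Px≗ j = trans (sym (from∘to P x j)) (apply-zero (from P j) Px≗)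

    forward : ∀ {x y} → Congruent f x y → Congruent f′ (to U · x) (to U · y)
    forward {x} {y} (w , x≡) = to P · w , λ j → begin
      apply (to U j) x                                ≡⟨ respects (to U j) x≡ ⟩
      apply (to U j) (λ i → y i + apply (f i) w)      ≡⟨ additive (to U j) y (f · w) ⟩
      apply (to U j) y + apply (to U j) (f · w)       ≡⟨ cong (_+_ (apply (to U j) y)) (intertwine w j) ⟩
      apply (to U j) y + apply (f′ j) (to P · w)      ∎

    backward : ∀ {x y} → Congruent f′ (to U · x) (to U · y) → Congruent f x y
    backward {x} {y} (w , Ux≡) = from P · w , λ j → begin
      x j                                                  ≡⟨ from∘to U x j ⟨
      apply (from U j) (to U · x)                          ≡⟨ respects (from U j) Ux≡ ⟩
      apply (from U j) (λ i → apply (to U i) y + apply (f′ i) w)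
        ≡⟨ additive (from U j) _ _ ⟩
      apply (from U j) (to U · y) + apply (from U j) (f′ · w)
        ≡⟨ cong₂ _+_ (from∘to U y j) (respects (from U j) λ i → trans
             (respects (f′ i) λ k → sym (to∘from P w k)) (sym (intertwine (from P · w) i))) ⟩
      y j + apply (from U j) (to U · f · from P · w)
        ≡⟨ cong (_+_ (y j)) (from∘to U (f · from P · w) j) ⟩
      y j + apply (f j) (from P · w) ∎

  Kernel-≅ : Kernel f′ → Kernel f
  Kernel-≅ (w , f′w≗ , i , wᵢ≢0) = from P · w
    , detarget (λ j → trans (intertwine _ j) (trans (respects (f′ j) (to∘from P w)) (f′w≗ j)))
    , nonzero
    where
    nonzero : ∃[ k ] apply (from P k) w ≢ 0ℤ
    -- The automorphism may move the nonzero coordinate elsewhere, so one is searched for; if all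
    -- vanished, applying `to P` would give wᵢ = 0.
    nonzero with Fin.any? (λ k → ¬? (apply (from P k) w ℤ.≟ 0ℤ))
    ... | yes found = found
    ... | no  none  = contradiction
      (trans (sym (to∘from P w i)) (apply-zero (to P i) λ k →
        decidable-stable (apply (from P k) w ℤ.≟ 0ℤ) (none ∘ (k ,_)))) wᵢ≢0

  Index-≅ : ∀ {d} → Index f′ d → Index f d
  Index-≅ I = record
    { injective = λ w fw≗ → desource (injective I (to P · w) λ j →
        trans (sym (intertwine w j)) (apply-zero (to U j) fw≗))
    ; class     = λ x → class I (to U · x)
    ; rep       = λ k → from U · rep I k
    ; class-rep = λ k → trans (sound I (≗⇒Congruent f′ (to∘from U (rep I k)))) (class-rep I k)
    ; sound     = λ {x} {y} x~y → sound I (forward {x} {y} x~y)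
    ; complete  = λ x~y → backward (complete I x~y) }

  HasDet-≅ : ∀ {z} → HasDet f′ z → HasDet f z
  HasDet-≅ (inj₁ (z≡0 , K)) = inj₁ (z≡0 , Kernel-≅ K)
  HasDet-≅ (inj₂ (z≢0 , I)) = inj₂ (z≢0 , Index-≅ I)

-- Residues modulo g and the cokernel of a block triangular matrix.

module _ (g : ℤ) .{{_ : ℤ.NonZero g}} where

  -- ∣g∣ ∣t∣ = ∣r - s∣ ≤ max r s < ∣g∣ forces t = 0.
  remainder-unique : ∀ {r s} t → r ℕ.< ∣ g ∣ → s ℕ.< ∣ g ∣ → + r ≡ + s + g * t → r ≡ s
  remainder-unique {r} {s} t r< s< r≡ = ℤ.+-injective (begin
    + r          ≡⟨ r≡ ⟩
    + s + g * t  ≡⟨ cong (λ u → + s + g * u) (ℤ.∣i∣≡0⇒i≡0 ∣t∣≡0) ⟩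
    + s + g * 0ℤ ≡⟨ cong (_+_ (+ s)) (ℤ.*-zeroʳ g) ⟩
    + s + 0ℤ     ≡⟨ ℤ.+-identityʳ (+ s) ⟩
    + s          ∎)
    where
    cancel : ∀ s u → (s + u) - s ≡ u
    cancel = solve-∀
    gt≡ : g * t ≡ r ℤ.⊖ s
    gt≡ = begin
      g * t                ≡⟨ cancel (+ s) (g * t) ⟨
      (+ s + g * t) - + s  ≡⟨ cong (_- + s) r≡ ⟨
      + r - + s            ≡⟨ ℤ.m-n≡m⊖n r s ⟩
      r ℤ.⊖ s              ∎
    small : ∣ g ∣ ℕ.* ∣ t ∣ ℕ.< ∣ g ∣
    small = subst (ℕ._< ∣ g ∣) (trans (cong ∣_∣ (sym gt≡)) (ℤ.abs-* g t))
      (ℕ.≤-<-trans (ℤ.∣m⊝n∣≤m⊔n r s) (ℕ.⊔-lub r< s<))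
    ∣t∣≡0 : ∣ t ∣ ≡ 0
    ∣t∣≡0 = ℕ.n<1⇒n≡0 (ℕ.*-cancelˡ-< ∣ g ∣ ∣ t ∣ 1
      (subst (∣ g ∣ ℕ.* ∣ t ∣ ℕ.<_) (sym (ℕ.*-identityʳ ∣ g ∣)) small))

  residue : ℤ → Fin ∣ g ∣
  residue a = fromℕ< (n%d<d a g)

  toℕ-residue : ∀ a → toℕ (residue a) ≡ a % g
  toℕ-residue a = Fin.toℕ-fromℕ< (n%d<d a g)

  residue-toℕ : ∀ k → residue (+ toℕ k) ≡ k
  residue-toℕ k = Fin.toℕ-injective (trans (toℕ-residue (+ toℕ k))
    (sym (remainder-unique (+ toℕ k / g) (Fin.toℕ<n k) (n%d<d (+ toℕ k) g)
      (trans (a≡a%n+[a/n]*n (+ toℕ k) g) (cong (_+_ (+ (+ toℕ k % g))) (ℤ.*-comm (+ toℕ k / g) g))))))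

  residue-sound : ∀ a b t → a ≡ b + g * t → residue a ≡ residue b
  residue-sound a b t a≡ = Fin.toℕ-injective (begin
    toℕ (residue a) ≡⟨ toℕ-residue a ⟩
    a % g           ≡⟨ remainder-unique (b / g + t - a / g) (n%d<d a g) (n%d<d b g) eq ⟩
    b % g           ≡⟨ toℕ-residue b ⟨
    toℕ (residue b) ∎)
    where
    isolate : ∀ r s g → (r + s * g) - s * g ≡ r
    isolate = solve-∀
    collect : ∀ r s t u g → (r + s * g + g * t) - u * g ≡ r + g * (s + t - u)
    collect = solve-∀
    eq : + (a % g) ≡ + (b % g) + g * (b / g + t - a / g)
    eq = begin
      + (a % g)                                     ≡⟨ isolate (+ (a % g)) (a / g) g ⟨
      (+ (a % g) + a / g * g) - a / g * g           ≡⟨ cong (_- a / g * g) (a≡a%n+[a/n]*n a g) ⟨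
      a - a / g * g                                 ≡⟨ cong (_- a / g * g) a≡ ⟩
      (b + g * t) - a / g * g                       ≡⟨ cong (λ c → (c + g * t) - a / g * g) (a≡a%n+[a/n]*n b g) ⟩
      (+ (b % g) + b / g * g + g * t) - a / g * g   ≡⟨ collect (+ (b % g)) (b / g) t (a / g) g ⟩
      + (b % g) + g * (b / g + t - a / g)           ∎

  residue-complete : ∀ a b → residue a ≡ residue b → ∃[ t ] a ≡ b + g * t
  residue-complete a b eq = a / g - b / g , (begin
    a                                ≡⟨ a≡a%n+[a/n]*n a g ⟩
    + (a % g) + a / g * g            ≡⟨ cong (λ r → + r + a / g * g)
                                          (trans (sym (toℕ-residue a)) (trans (cong toℕ eq) (toℕ-residue b))) ⟩
    + (b % g) + a / g * g            ≡⟨ collect (+ (b % g)) (b / g) (a / g) g ⟩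
    (+ (b % g) + b / g * g) + g * (a / g - b / g) ≡⟨ cong (_+ g * (a / g - b / g)) (a≡a%n+[a/n]*n b g) ⟨
    b + g * (a / g - b / g)          ∎)
    where
    collect : ∀ r s u g → r + u * g ≡ (r + s * g) + g * (u - s)
    collect = solve-∀

module _ {m n} (g : ℤ) (s : Functional m) (f : m ⊸ n) where

  Kernel-block-0 : g ≡ 0ℤ → Kernel (block g s f)
  Kernel-block-0 refl = basis zero
    , (λ { zero → cong (_+_ 0ℤ) (apply-zero s λ _ → refl) ; (suc j) → apply-zero (f j) λ _ → refl })
    , zero , λ ()

  -- Scaling `w` by `g` makes the first row solvable over ℤ without division: g (- s w) + s (g w) =
  -- 0.
  Kernel-block : g ≢ 0ℤ → Kernel f → Kernel (block g s f)
  Kernel-block g≢0 (w , fw≗ , i , wᵢ≢0) = - apply s w ◂ (λ i → g * w i)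
    , (λ { zero → trans (cong (_+_ (g * - apply s w)) (homogeneous s g w)) (cancel g (apply s w))
         ; (suc j) → trans (homogeneous (f j) g w) (trans (cong (g *_) (fw≗ j)) (ℤ.*-zeroʳ g)) })
    , suc i , λ gw≡0 → [ g≢0 , wᵢ≢0 ] (ℤ.i*j≡0⇒i≡0∨j≡0 g gw≡0)
    where
    cancel : ∀ a b → a * - b + a * b ≡ 0ℤ
    cancel = solve-∀

  module _ (g≢0 : g ≢ 0ℤ) {d} (I : Index f d) where
    private
      instance _ = ℤ.≢-nonZero g≢0

      unique : ∀ (x y : ℤ^ n) (u v : ℤ^ m) →
        (∀ j → x j ≡ y j + apply (f j) u) → (∀ j → x j ≡ y j + apply (f j) v) → u ≗ v
      unique x y u v eq eq′ i = ℤ.i-j≡0⇒i≡j (u i) (v i) (injective I (λ i → u i - v i) (λ j → begin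
        apply (f j) (λ i → u i - v i)   ≡⟨ apply-minus (f j) u v ⟩
        apply (f j) u - apply (f j) v   ≡⟨ ℤ.i≡j⇒i-j≡0
          (∙-cancelˡ (y j) (apply (f j) u) (apply (f j) v) (trans (sym (eq j)) (eq′ j))) ⟩
        0ℤ ∎) i)

      k : ℤ^ (suc n) → Fin d
      k x = class I (tail x)

      offset : ∀ x → Congruent f (tail x) (rep I (k x))
      offset x = complete I (sym (class-rep I (k x)))

      w : ℤ^ (suc n) → ℤ^ m
      w x = proj₁ (offset x)

      ρ : ℤ^ (suc n) → ℤ
      ρ x = head x - apply s (w x)

      w-unique : ∀ x k′ v → k x ≡ k′ → (∀ j → tail x j ≡ rep I k′ j + apply (f j) v) → w x ≗ v
      w-unique x _ v refl = unique (tail x) (rep I (k x)) (w x) v (proj₂ (offset x))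

    -- Injectivity of `f` leaves exactly one combination `w x` of its columns that carries the tail
    -- of `x` to its representative. Subtracting it changes the first coordinate to `ρ x`, which
    -- then matters only modulo `g`. A class is thus a residue of `ρ x` paired with a class of the
    -- tail.
    Index-block : Index (block g s f) (∣ g ∣ ℕ.* d)
    Index-block = record
      { injective = λ v eq →
          let tail≗ = injective I (tail v) (eq ∘ suc)
              gv₀≡0 = trans (sym (ℤ.+-identityʳ _))
                (trans (cong (_+_ (g * v zero)) (sym (apply-zero s tail≗))) (eq zero))
          in λ { zero → [ (λ g≡0 → contradiction g≡0 g≢0) , (λ e → e) ] (ℤ.i*j≡0⇒i≡0∨j≡0 g gv₀≡0)
               ; (suc i) → tail≗ i }
      ; class     = λ x → combine (residue g (ρ x)) (k x)
      ; rep       = λ c → let i , l = remQuot {∣ g ∣} d c in + toℕ i ◂ rep I l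
      ; class-rep = class-rep′
      ; sound     = λ {x} {y} → sound′ x y
      ; complete  = λ {x} {y} → complete′ x y }
      where
      class-rep′ : ∀ c → _
      class-rep′ c = begin
        combine (residue g (ρ x)) (k x)       ≡⟨ cong₂ combine (cong (residue g) ρ≡) (class-rep I l) ⟩
        combine (residue g (+ toℕ i)) l       ≡⟨ cong (λ i → combine i l) (residue-toℕ g i) ⟩
        combine i l                           ≡⟨ Fin.combine-remQuot {∣ g ∣} d c ⟩
        c                                     ∎
        where
        i = proj₁ (remQuot {∣ g ∣} d c)
        l = proj₂ (remQuot {∣ g ∣} d c)
        x = + toℕ i ◂ rep I l
        ρ≡ : ρ x ≡ + toℕ i
        -- The tail is already its own representative, so by uniqueness its offset is zero and `ρ`
        -- leaves the first coordinate alone.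
        ρ≡ = trans (cong (λ u → + toℕ i - u) (apply-zero s (w-unique x l 𝟎 (class-rep I l)
          (proj₂ (≗⇒Congruent f {rep I l} (λ _ → refl))))))
          (ℤ.+-identityʳ _)

      sound′ : ∀ x y → Congruent (block g s f) x y → _
      sound′ x y (v , eq) = cong₂ combine (residue-sound g (ρ x) (ρ y) (v zero) (begin
        x zero - apply s (w x)
          ≡⟨ cong₂ _-_ (eq zero) (trans (respects s w≗) (additive s (w y) (tail v))) ⟩
        (y zero + (g * v zero + apply s (tail v))) - (apply s (w y) + apply s (tail v))
          ≡⟨ rearrange (y zero) (g * v zero) (apply s (tail v)) (apply s (w y)) ⟩
        y zero - apply s (w y) + g * v zero ∎)) kx≡ky
        where
        rearrange : ∀ a b c d → (a + (b + c)) - (d + c) ≡ a - d + b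
        rearrange = solve-∀
        kx≡ky : k x ≡ k y
        kx≡ky = sound I (tail v , eq ∘ suc)
        -- The offsets of `x` and `y` differ by exactly `tail v`, so the contribution of `s` cancels
        -- in `ρ` and a multiple of `g` remains.
        w≗ : w x ≗ λ i → w y i + tail v i
        w≗ = w-unique x (k y) _ kx≡ky λ j → begin
          x (suc j)                                                    ≡⟨ eq (suc j) ⟩
          y (suc j) + apply (f j) (tail v)                             ≡⟨ cong (_+ _) (proj₂ (offset y) j) ⟩
          rep I (k y) j + apply (f j) (w y) + apply (f j) (tail v)     ≡⟨ ℤ.+-assoc (rep I (k y) j) _ _ ⟩
          rep I (k y) j + (apply (f j) (w y) + apply (f j) (tail v))
            ≡⟨ cong (_+_ (rep I (k y) j)) (additive (f j) (w y) (tail v)) ⟨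
          rep I (k y) j + apply (f j) (λ i → w y i + tail v i)         ∎

      complete′ : ∀ x y → combine (residue g (ρ x)) (k x) ≡ combine (residue g (ρ y)) (k y) →
                  Congruent (block g s f) x y
      complete′ x y eq = t ◂ v , λ
        { zero → begin
            x zero                                     ≡⟨ isolate (x zero) (apply s (w x)) ⟩
            ρ x + apply s (w x)                        ≡⟨ cong (_+ apply s (w x)) ρ≡ ⟩
            (y zero - apply s (w y)) + g * t + apply s (w x)
              ≡⟨ rearrange (y zero) (apply s (w y)) (g * t) (apply s (w x)) ⟩
            y zero + (g * t + (apply s (w x) - apply s (w y)))
              ≡⟨ cong (λ u → y zero + (g * t + u)) (apply-minus s (w x) (w y)) ⟨
            y zero + (g * t + apply s v)               ∎
        ; (suc j) → begin
            x (suc j)                                  ≡⟨ proj₂ (offset x) j ⟩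
            rep I (k x) j + apply (f j) (w x)          ≡⟨ cong (λ l → rep I l j + apply (f j) (w x)) kx≡ky ⟩
            rep I (k y) j + apply (f j) (w x)
              ≡⟨ regroup (rep I (k y) j) (apply (f j) (w x)) (apply (f j) (w y)) ⟩
            (rep I (k y) j + apply (f j) (w y)) + (apply (f j) (w x) - apply (f j) (w y))
              ≡⟨ cong₂ _+_ (proj₂ (offset y) j) (apply-minus (f j) (w x) (w y)) ⟨
            y (suc j) + apply (f j) v                  ∎ }
        where
        isolate : ∀ a b → a ≡ (a - b) + b
        isolate = solve-∀
        rearrange : ∀ a b c d → (a - b) + c + d ≡ a + (c + (d - b))
        rearrange = solve-∀
        regroup : ∀ a b c → a + b ≡ (a + c) + (b - c)
        regroup = solve-∀
        split = Fin.combine-injective (residue g (ρ x)) (k x) _ _ eq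
        kx≡ky = proj₂ split
        t  = proj₁ (residue-complete g (ρ x) (ρ y) (proj₁ split))
        ρ≡ = proj₂ (residue-complete g (ρ x) (ρ y) (proj₁ split))
        v : ℤ^ m
        v i = w x i - w y i

  HasDet-block : ∀ {z} → HasDet f z → HasDet (block g s f) (g * z)
  HasDet-block {z} det with g ℤ.≟ 0ℤ | det
  ... | yes g≡0 | _                 = inj₁ (cong (_* z) g≡0 , Kernel-block-0 g≡0)
  ... | no  g≢0 | inj₁ (z≡0 , K)    = inj₁ (trans (cong (g *_) z≡0) (ℤ.*-zeroʳ g) , Kernel-block g≢0 K)
  ... | no  g≢0 | inj₂ (z≢0 , I)    = inj₂
    ( (λ gz≡0 → [ g≢0 , z≢0 ] (ℤ.i*j≡0⇒i≡0∨j≡0 g gz≡0))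
    , subst (Index (block g s f)) (sym (ℤ.abs-* g z)) (Index-block g≢0 I))

-- Triangular form and the determinant as a functional of one column.

triangularise : ∀ {m n} (f : suc m ⊸ suc n) →
                ∃[ g ] Σ[ s ∈ Functional m ] Σ[ f′ ∈ m ⊸ n ] f ≅ block g s f′
triangularise f = g , to U zero ∘ᶠ otherColumns f , (to U ∘ suc) ⊚ otherColumns f , record
  { target = U ; source = identity
  ; intertwine = λ
    { w zero    → trans (expand (to U zero ∘ᶠ f) w) (cong (λ a → a * w zero + rest zero w) (Uc≗ zero))
    ; w (suc j) → trans (expand (to U (suc j) ∘ᶠ f) w)
        (trans (cong (λ a → a * w zero + rest (suc j) w) (Uc≗ (suc j))) (ℤ.+-identityˡ (rest (suc j) w))) } }
  where
  reduced = reduce (firstColumn f)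
  g = proj₁ reduced
  U = proj₁ (proj₂ reduced)
  Uc≗ = proj₂ (proj₂ reduced)
  rest : ∀ j → _ → ℤ
  rest j w = apply (to U j ∘ᶠ otherColumns f) (tail w)

-- Each triangularisation removes one row and one column, so the rows run out first; a zero on the
-- diagonal gives a kernel vector earlier.
wide⇒Kernel : ∀ {m n} (f : m ⊸ n) → n ℕ.< m → Kernel f
wide⇒Kernel {suc m} {zero}  f n<m = basis zero , (λ ()) , zero , λ ()
wide⇒Kernel {suc m} {suc n} f n<m with triangularise f
... | g , s , f′ , f≅ with g ℤ.≟ 0ℤ
...   | yes g≡0 = Kernel-≅ f≅ (Kernel-block-0 g s f′ g≡0)
...   | no  g≢0 = Kernel-≅ f≅ (Kernel-block g s f′ g≢0 (wide⇒Kernel f′ (ℕ.s<s⁻¹ n<m)))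

HasDet-empty : (f : 0 ⊸ 0) → HasDet f 1ℤ
HasDet-empty f = inj₂ ((λ ()) , record
  { injective = λ _ _ () ; class = λ _ → zero ; rep = λ _ () ; class-rep = λ { zero → refl }
  ; sound = λ _ → refl ; complete = λ _ → 𝟎 , λ () })

-- With g , U the triangularisation of the first column of f, the functional is v ↦ g μ (U v)₁…,
-- μ being the functional of the remaining columns of U f.
det-adjoin : ∀ {n} (f : n ⊸ suc n) →
             Σ[ δ ∈ Functional (suc n) ] (∀ v → HasDet (adjoin v f) (apply δ v))
det-adjoin {zero}  f = coordinate zero , λ v →
  subst (HasDet (adjoin v f)) (ℤ.*-identityʳ (v zero))
    (HasDet-≅ (≅-block v) (HasDet-block (v zero) null (λ ()) (HasDet-empty _)))
  where
  ≅-block : ∀ v → adjoin v f ≅ block (v zero) null (λ ())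
  ≅-block v = record
    { target = identity ; source = identity
    ; intertwine = λ { w zero → cong (_+_ (v zero * w zero)) (apply-zero (f zero) λ ()) } }
det-adjoin {suc n} f = g *ᶠ (proj₁ IH ∘ᶠ (to U ∘ suc)) , λ v →
  HasDet-≅ (≅-block v) (HasDet-block g _ _ (proj₂ IH (tail (to U · v))))
  where
  reduced = reduce (firstColumn f)
  g = proj₁ reduced
  U = proj₁ (proj₂ reduced)
  Uc≗ = proj₂ (proj₂ reduced)
  f′ : n ⊸ suc n
  f′ = (to U ∘ suc) ⊚ otherColumns f
  IH = det-adjoin f′

  ≅-block : ∀ v → adjoin v f ≅ block g (extend (apply (to U zero) v) (to U zero ∘ᶠ otherColumns f))
                                        (adjoin (tail (to U · v)) f′)
  ≅-block v = record
    -- In `adjoin v f` the column `v` comes first, but the reduced column has to lead the block.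
    -- Exchanging the two costs a sign only.
    { target = U ; source = permute (transpose zero (suc zero))
    ; intertwine = λ
      { w zero    → trans (split w zero) (swap₀ (apply (to U zero) v * w zero) g (w (suc zero)) _ _ (Uc≗ zero))
      ; w (suc j) → trans (split w (suc j))
          (swap₁ (apply (to U (suc j)) v * w zero) (w (suc zero)) _ _ (Uc≗ (suc j))) } }
    where
    split : ∀ w j → apply (to U j) (adjoin v f · w) ≡
      apply (to U j) v * w zero + (apply (to U j) (firstColumn f) * w (suc zero)
                                   + apply (to U j ∘ᶠ otherColumns f) (tail (tail w)))
    split w j = begin
      apply (to U j) (λ i → v i * w zero + apply (f i) (tail w))
        ≡⟨ additive (to U j) _ _ ⟩
      apply (to U j) (λ i → v i * w zero) + apply (to U j) (f · tail w)
        ≡⟨ cong₂ _+_ (trans (respects (to U j) λ i → ℤ.*-comm (v i) (w zero))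
                      (trans (homogeneous (to U j) (w zero) v) (ℤ.*-comm (w zero) _)))
             (expand (to U j ∘ᶠ f) (tail w)) ⟩
      _ ∎
    swap₀ : ∀ a g b c h → h ≡ g → a + (h * b + c) ≡ g * b + (a + c)
    swap₀ a g b c .g refl = solve (a ∷ g ∷ b ∷ c ∷ [])
    swap₁ : ∀ a b c h → h ≡ 0ℤ → a + (h * b + c) ≡ a + c
    swap₁ a b c .0ℤ refl = cong (_+_ a) (ℤ.+-identityˡ c)

-- Comparison of the determinant with a permanent.

Index-≤ : ∀ {m n d d′} {f : m ⊸ n} → Index f d → Index f d′ → d ℕ.≤ d′
Index-≤ I J = Fin.injective⇒≤ {f = class J ∘ rep I} λ {k} {l} eq →
  trans (sym (class-rep I k)) (trans (sound I (complete J eq)) (class-rep I l))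

injective⇒¬Kernel : ∀ {m n} (f : m ⊸ n) → (∀ w → f · w ≗ 𝟎 → w ≗ 𝟎) → ¬ Kernel f
injective⇒¬Kernel _ inj (w , fw≗𝟎 , i , wᵢ≢0) = wᵢ≢0 (inj w fw≗𝟎 i)

-- Different reductions of one matrix may produce different values of `z`. The cokernel fixes the
-- absolute value, and this is how δ eᵢ gets compared with the determinant of a minor.
HasDet-unique : ∀ {m n} {f : m ⊸ n} {z z′} → HasDet f z → HasDet f z′ → ∣ z ∣ ≡ ∣ z′ ∣
HasDet-unique (inj₁ (refl , _)) (inj₁ (refl , _)) = refl
HasDet-unique {f = f} (inj₁ (_ , K)) (inj₂ (_ , I)) = contradiction K (injective⇒¬Kernel f (injective I))
HasDet-unique {f = f} (inj₂ (_ , I)) (inj₁ (_ , K)) = contradiction K (injective⇒¬Kernel f (injective I))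
HasDet-unique (inj₂ (_ , I)) (inj₂ (_ , J)) = ℕ.≤-antisym (Index-≤ I J) (Index-≤ J I)

-- Defined by recursion through `extend`, so that `matrix A` is by computation `adjoin` of its first
-- column to the matrix of the others; `det` and `∣det∣≤count` use this silently.
dot : ∀ {n} → ℤ^ n → Functional n
dot {zero}  a = null
dot {suc n} a = extend (head a) (dot (tail a))

dot-sum : ∀ {n} (a x : ℤ^ n) → apply (dot a) x ≡ ℤΣ.sum (λ i → a i * x i)
dot-sum {zero}  a x = refl
dot-sum {suc n} a x = cong (_+_ (a zero * x zero)) (dot-sum (tail a) (tail x))

matrix : ∀ {m n} → (Fin n → Fin m → ℤ) → m ⊸ n
matrix A i = dot (A i)

det : ∀ {n} (A : Fin n → Fin n → ℤ) → ∃[ z ] HasDet (matrix A) z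
det {zero}  A = 1ℤ , HasDet-empty _
det {suc n} A =
  let δ , hasDet = det-adjoin (matrix λ i → tail (A i)) in _ , hasDet (λ i → A i zero)

basis-diagonal : ∀ {n} (i : Fin n) → basis i i ≡ 1ℤ
basis-diagonal zero    = refl
basis-diagonal (suc i) = basis-diagonal i

basis-punchIn : ∀ {n} (i : Fin (suc n)) k → basis i (punchIn i k) ≡ 0ℤ
basis-punchIn zero            k       = refl
basis-punchIn {suc n} (suc i) zero    = refl
basis-punchIn {suc n} (suc i) (suc k) = basis-punchIn i k

-- Moving row `i` to the top turns the column `basis i` into the first unit vector, which leaves a
-- block with diagonal entry 1 over the minor.
HasDet-minor : ∀ {n} i (B : Fin (suc n) → Fin n → ℤ) {z} →
               HasDet (matrix (B ∘ punchIn i)) z → HasDet (adjoin (basis i) (matrix B)) z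
HasDet-minor i B {z} D = subst (HasDet _) (ℤ.*-identityˡ z)
  (HasDet-≅ ≅-block (HasDet-block 1ℤ (dot (B i)) _ D))
  where
  π = insert zero i Perm.id
  ≅-block : adjoin (basis i) (matrix B) ≅ block 1ℤ (dot (B i)) (matrix (B ∘ punchIn i))
  ≅-block = record
    { target = permute π ; source = identity
    ; intertwine = λ
      { w zero    → cong (λ a → a * w zero + apply (dot (B i)) (tail w)) (basis-diagonal i)
      ; w (suc k) → begin
          basis i (π ⟨$⟩ʳ suc k) * w zero + apply (dot (B (π ⟨$⟩ʳ suc k))) (tail w)
            ≡⟨ cong (λ r → basis i r * w zero + apply (dot (B r)) (tail w)) (insert-punchIn zero i Perm.id k) ⟩
          basis i (punchIn i k) * w zero + apply (dot (B (punchIn i k))) (tail w)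
            ≡⟨ cong (λ a → a * w zero + apply (dot (B (punchIn i k))) (tail w)) (basis-punchIn i k) ⟩
          0ℤ + apply (dot (B (punchIn i k))) (tail w)
            ≡⟨ ℤ.+-identityˡ _ ⟩
          apply (dot (B (punchIn i k))) (tail w) ∎ } }

∣apply∣≤ : ∀ {n} (g : Functional n) x (b : Fin n → ℕ) →
           (∀ i → ∣ apply g (basis i) ∣ ℕ.* ∣ x i ∣ ℕ.≤ b i) → ∣ apply g x ∣ ℕ.≤ ℕΣ.sum b
∣apply∣≤ {zero}  g x b b≥ = ℕ.≤-reflexive (cong ∣_∣ (apply-zero g λ ()))
∣apply∣≤ {suc n} g x b b≥ = subst (λ y → ∣ y ∣ ℕ.≤ ℕΣ.sum b) (sym (expand g x))
  (ℕ.≤-trans (ℤ.∣i+j∣≤∣i∣+∣j∣ (apply g (basis zero) * x zero) _)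
    (ℕ.+-mono-≤ (subst (ℕ._≤ b zero) (sym (ℤ.abs-* (apply g (basis zero)) (x zero))) (b≥ zero))
      (∣apply∣≤ (g ∘ᶠ shift) (tail x) (tail b) λ i →
        subst (λ y → ∣ y ∣ ℕ.* ∣ x (suc i) ∣ ℕ.≤ b (suc i))
          (respects g λ { zero → refl ; (suc j) → refl }) (b≥ (suc i)))))

minor : ∀ {n} → (Fin (suc n) → Fin (suc n) → Bool) → Fin (suc n) → Fin n → Fin n → Bool
minor P i r c = P (punchIn i r) (suc c)

-- The permanent of P, expanded along the first column.
count : ∀ {n} → (Fin n → Fin n → Bool) → ℕ
count {zero}  P = 1
count {suc n} P = ℕΣ.sum λ i → if P i zero then count (minor P i) else 0

-- The summand of `count`, named so that `unsum` can split an element of `Fin (count P)` into a row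
-- and an index for its minor.
weight : ∀ {n} → (Fin (suc n) → Fin (suc n) → Bool) → Fin (suc n) → ℕ
weight P i = if P i zero then count (minor P i) else 0

∣det∣≤count : ∀ {n} (A : Fin n → Fin n → ℤ) (P : Fin n → Fin n → Bool) →
              (∀ r c → ∣ A r c ∣ ℕ.≤ (if P r c then 1 else 0)) →
              ∀ {z} → HasDet (matrix A) z → ∣ z ∣ ℕ.≤ count P
∣det∣≤count {zero}  A P A≤P D = ℕ.≤-reflexive (HasDet-unique D (HasDet-empty _))
∣det∣≤count {suc n} A P A≤P D =
  -- The given value and that of `δ` belong to the same matrix but need agree only in absolute
  -- value.
  subst (ℕ._≤ count P) (HasDet-unique (hasDet (λ i → A i zero)) D)
    (∣apply∣≤ δ (λ i → A i zero) _ term)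
  where
  B : Fin (suc n) → Fin n → ℤ
  B i = tail (A i)
  δ = proj₁ (det-adjoin (matrix B))
  hasDet = proj₂ (det-adjoin (matrix B))
  minor≤ : ∀ i → ∣ apply δ (basis i) ∣ ℕ.≤ count (minor P i)
  minor≤ i = let z , D′ = det (B ∘ punchIn i) in
    subst (ℕ._≤ _) (HasDet-unique (HasDet-minor i B D′) (hasDet (basis i)))
      (∣det∣≤count (B ∘ punchIn i) _ (λ r c → A≤P (punchIn i r) (suc c)) D′)
  d : ∀ i → ℕ
  d i = ∣ apply δ (basis i) ∣
  term : ∀ i → d i ℕ.* ∣ A i zero ∣ ℕ.≤ weight P i
  term i with P i zero | A≤P i zero
  ... | true  | A≤1 = ℕ.≤-trans (ℕ.*-monoʳ-≤ (d i) A≤1)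
                        (ℕ.≤-trans (ℕ.≤-reflexive (ℕ.*-identityʳ (d i))) (minor≤ i))
  ... | false | A≤0 = ℕ.≤-trans (ℕ.*-monoʳ-≤ (d i) A≤0) (ℕ.≤-reflexive (ℕ.*-zeroʳ (d i)))

-- Enumeration of the permutations counted by a permanent.

injective∧surjective⇒inverse : ∀ {m} (S : Setoid 0ℓ 0ℓ) → let open Setoid S in
  (to : Fin m → Carrier) → (∀ {k l} → to k ≈ to l → k ≡ l) → (∀ x → ∃[ k ] to k ≈ x) →
  Inverse (setoid (Fin m)) S
injective∧surjective⇒inverse S to inj surj = record
  { to = to
  ; from = λ x → proj₁ (surj x)
  ; to-cong = λ { refl → S.refl }
  ; from-cong = λ {x} {y} x≈y → inj (S.trans (proj₂ (surj x)) (S.trans x≈y (S.sym (proj₂ (surj y)))))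
  ; inverse = (λ { {x} refl → proj₂ (surj x) })
            , (λ {k} {x} x≈tok → inj (S.trans (proj₂ (surj x)) x≈tok)) }
  where module S = Setoid S

unsum : ∀ {n} (f : Fin n → ℕ) → Fin (ℕΣ.sum f) → Σ (Fin n) (Fin ∘ f)
unsum {suc n} f k with splitAt (f zero) k
... | inj₁ a = zero , a
... | inj₂ b = let i , a = unsum (tail f) b in suc i , a

unsum-surjective : ∀ {n} (f : Fin n → ℕ) x → ∃[ k ] unsum f k ≡ x
unsum-surjective {suc n} f (zero , a) = a ↑ˡ _ , lemma
  where
  lemma : unsum f (a ↑ˡ _) ≡ (zero , a)
  lemma rewrite Fin.splitAt-↑ˡ (f zero) a (ℕΣ.sum (tail f)) = refl
unsum-surjective {suc n} f (suc i , a) with unsum-surjective (tail f) (i , a)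
... | k , refl = f zero ↑ʳ k , lemma
  where
  lemma : unsum f (f zero ↑ʳ k) ≡ _
  lemma rewrite Fin.splitAt-↑ʳ (f zero) (ℕΣ.sum (tail f)) k = refl

unsum-injective : ∀ {n} (f : Fin n → ℕ) {k l} → unsum f k ≡ unsum f l → k ≡ l
unsum-injective {suc n} f {k} {l} eq with splitAt (f zero) k in eqₖ | splitAt (f zero) l in eqₗ
unsum-injective {suc n} f {k} {l} refl | inj₁ a | inj₁ .a =
  trans (sym (Fin.splitAt⁻¹-↑ˡ eqₖ)) (Fin.splitAt⁻¹-↑ˡ eqₗ)
... | inj₁ a | inj₂ b = contradiction (cong proj₁ eq) λ ()
... | inj₂ a | inj₁ b = contradiction (cong proj₁ eq) λ ()
... | inj₂ a | inj₂ b = trans (sym (Fin.splitAt⁻¹-↑ʳ eqₖ)) (trans (cong (f zero ↑ʳ_)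
        (unsum-injective (tail f) (pred-≡ _ _ eq))) (Fin.splitAt⁻¹-↑ʳ eqₗ))
  where
  pred-≡ : ∀ (x y : Σ (Fin n) (Fin ∘ tail f)) →
           _≡_ {A = Σ (Fin (suc n)) (Fin ∘ f)} (suc (proj₁ x) , proj₂ x) (suc (proj₁ y) , proj₂ y) → x ≡ y
  pred-≡ (_ , _) (_ , _) refl = refl

unguard : ∀ b {c} → Fin (if b then c else 0) → T b × Fin c
unguard true k = tt , k

unguard-injective : ∀ b {c} {k l : Fin (if b then c else 0)} →
                    proj₂ (unguard b k) ≡ proj₂ (unguard b l) → k ≡ l
unguard-injective true eq = eq

unguard-surjective : ∀ b {c} → T b → (x : Fin c) → ∃[ k ] proj₂ (unguard b k) ≡ x
unguard-surjective true _ x = x , refl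

insert-self : ∀ {m n} i j (π : Permutation m n) → insert i j π ⟨$⟩ʳ i ≡ j
insert-self i j π with i Fin.≟ i
... | yes _   = refl
... | no  i≢i = contradiction refl i≢i

punchIn-view : ∀ {n} {ℓ} i (Q : Fin (suc n) → Set ℓ) → Q i → (∀ k → Q (punchIn i k)) → ∀ r → Q r
punchIn-view i Q Qi Q[punchIn] r with i Fin.≟ r
... | yes refl = Qi
... | no  i≢r  = subst Q (Fin.punchIn-punchOut i≢r) (Q[punchIn] (punchOut i≢r))

Fits : ∀ {m n} → (Fin m → Fin n → Bool) → Permutation m n → Set
Fits P π = ∀ r → T (P r (π ⟨$⟩ʳ r))

-- Follows the expansion in `count`: the chosen summand `i` is the row matched to column zero, and
-- the minor supplies the rest. An inhabited summand forces `P i zero` to be true, which `unguard`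
-- extracts.
matching : ∀ {n} (P : Fin n → Fin n → Bool) → Fin (count P) → Permutation n n
matching {zero}  P k = Perm.id
matching {suc n} P k = let i , a = unsum (weight P) k in
  insert i zero (matching (minor P i) (proj₂ (unguard (P i zero) a)))

matching-fits : ∀ {n} (P : Fin n → Fin n → Bool) k → Fits P (matching P k)
matching-fits {suc n} P k = punchIn-view i _
  (subst (T ∘ P i) (sym (insert-self i zero π)) (proj₁ (unguard (P i zero) a)))
  λ r → subst (T ∘ P (punchIn i r)) (sym (insert-punchIn i zero π r))
    (matching-fits (minor P i) (proj₂ (unguard (P i zero) a)) r)
  where
  i = proj₁ (unsum (weight P) k)
  a = proj₂ (unsum (weight P) k)
  π = matching (minor P i) (proj₂ (unguard (P i zero) a))

-- The inserted row is the only one sent to column zero; any other row goes to a successor.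
insert-injectiveˡ : ∀ {n} i j (π ρ : Permutation n n) →
                    insert i zero π Perm.≈ insert j zero ρ → i ≡ j
insert-injectiveˡ i j π ρ eq with j Fin.≟ i
... | yes j≡i = sym j≡i
... | no  j≢i = contradiction (begin
  zero                                          ≡⟨ insert-self i zero π ⟨
  insert i zero π ⟨$⟩ʳ i                        ≡⟨ eq i ⟩
  insert j zero ρ ⟨$⟩ʳ i                        ≡⟨ cong (insert j zero ρ ⟨$⟩ʳ_) (Fin.punchIn-punchOut j≢i) ⟨
  insert j zero ρ ⟨$⟩ʳ punchIn j (punchOut j≢i) ≡⟨ insert-punchIn j zero ρ _ ⟩
  suc (ρ ⟨$⟩ʳ punchOut j≢i)                     ∎) λ ()

matching-injective : ∀ {n} (P : Fin n → Fin n → Bool) {k l} →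
                     matching P k Perm.≈ matching P l → k ≡ l
matching-injective {zero}  P {zero} {zero} _ = refl
matching-injective {suc n} P {k} {l} eq = unsum-injective (weight P)
  (same (unsum (weight P) k) (unsum (weight P) l) eq)
  where
  perm : Σ (Fin (suc n)) (Fin ∘ weight P) → _
  perm (i , a) = insert i zero (matching (minor P i) (proj₂ (unguard (P i zero) a)))
  same : ∀ x y → perm x Perm.≈ perm y → x ≡ y
  same (i , a) (j , b) eq with insert-injectiveˡ i j _ _ eq
  ... | refl = cong (i ,_) (unguard-injective (P i zero) (matching-injective (minor P i) λ r →
    Fin.suc-injective (trans (sym (insert-punchIn i zero _ r)) (trans (eq (punchIn i r))
      (insert-punchIn i zero _ r)))))

matching-surjective : ∀ {n} (P : Fin n → Fin n → Bool) π → Fits P π → ∃[ k ] matching P k Perm.≈ π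
matching-surjective {zero}  P π fits = zero , λ ()
matching-surjective {suc n} P π fits = k , eq
  where
  -- The row matched to column zero selects the summand of the expansion.
  i = π ⟨$⟩ˡ zero
  πi≡0 : π ⟨$⟩ʳ i ≡ zero
  πi≡0 = inverseʳ π
  permute-suc : ∀ r → π ⟨$⟩ʳ punchIn i r ≡ suc (remove i π ⟨$⟩ʳ r)
  permute-suc r = trans (Perm.punchIn-permute π i r) (cong (λ j → punchIn j (remove i π ⟨$⟩ʳ r)) πi≡0)
  IH = matching-surjective (minor P i) (remove i π) λ r →
    subst (T ∘ P (punchIn i r)) (permute-suc r) (fits (punchIn i r))
  guarded = unguard-surjective (P i zero) (subst (T ∘ P i) πi≡0 (fits i)) (proj₁ IH)
  indexed = unsum-surjective (weight P) (i , proj₁ guarded)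
  k = proj₁ indexed
  eq : matching P k Perm.≈ π
  eq rewrite proj₂ indexed | proj₂ guarded = punchIn-view i _
    (trans (insert-self i zero _) (sym πi≡0))
    λ r → trans (insert-punchIn i zero _ r) (trans (cong suc (proj₂ IH r)) (sym (permute-suc r)))

-- Numbering the members of a family of subsets.

lookup-injective : ∀ {A : Set} {xs : List A} → Unique xs → ∀ {i j} → lookup xs i ≡ lookup xs j → i ≡ j
lookup-injective (_  ∷ _)   {zero}  {zero}  _  = refl
lookup-injective (x∉ ∷ _)   {zero}  {suc j} eq = contradiction eq (All.lookup x∉ (∈-lookup j))
lookup-injective (x∉ ∷ _)   {suc i} {zero}  eq = contradiction (sym eq) (All.lookup x∉ (∈-lookup i))
lookup-injective (_  ∷ xs!) {suc i} {suc j} eq = cong suc (lookup-injective xs! eq)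

subsets-unique : ∀ n → Unique (subsets n)
subsets-unique zero    = All.[] ∷ []
subsets-unique (suc n) = Unique.++⁺
  (Unique.map⁺ Vec.∷-injectiveʳ (subsets-unique n)) (Unique.map⁺ Vec.∷-injectiveʳ (subsets-unique n))
  λ (s∈ , s∈′) → let _ , _ , eq = ∈-map⁻ _ s∈ ; _ , _ , eq′ = ∈-map⁻ _ s∈′ in
    contradiction (Vec.∷-injectiveˡ (trans (sym eq) eq′)) λ ()

∈-subsets : ∀ {n} (s : Subset n) → s ∈ subsets n
∈-subsets Vec.[]              = here refl
∈-subsets (outside Vec.∷ s) = ∈-++⁺ˡ (∈-map⁺ _ (∈-subsets s))
∈-subsets {suc n} (inside  Vec.∷ s) = ∈-++⁺ʳ (List.map (outside Vec.∷_) (subsets n)) (∈-map⁺ _ (∈-subsets s))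

module _ {n} (S : Family n) where

  El-≡ : {s t : El S} → proj₁ s ≡ proj₁ t → s ≡ t
  El-≡ {s , p} {.s , q} refl = cong (s ,_) (Bool.T-irrelevant p q)

  private
    choose : List (Subset n) → List (El S)
    choose = mapMaybe (λ s → Maybe.map (s ,_) (dec⇒maybe (T? (S s))))

    ∈-choose⁻ : ∀ xs {e} → e ∈ choose xs → proj₁ e ∈ xs
    ∈-choose⁻ (x ∷ xs) e∈ with T? (S x) | e∈
    ... | yes _ | here refl = here refl
    ... | yes _ | there e∈′ = there (∈-choose⁻ xs e∈′)
    ... | no  _ | e∈′       = there (∈-choose⁻ xs e∈′)

    ∈-choose⁺ : ∀ xs (e : El S) → proj₁ e ∈ xs → e ∈ choose xs
    ∈-choose⁺ (x ∷ xs) e e∈ with T? (S x) | e∈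
    ... | yes _  | here refl = here (El-≡ refl)
    ... | no ¬p  | here refl = contradiction (proj₂ e) ¬p
    ... | yes _  | there e∈′ = there (∈-choose⁺ xs e e∈′)
    ... | no  _  | there e∈′ = ∈-choose⁺ xs e e∈′

    choose-unique : ∀ {xs} → Unique xs → Unique (choose xs)
    choose-unique {[]}     [] = []
    choose-unique {x ∷ xs} (x∉ ∷ xs!) with T? (S x)
    ... | yes _ = All.tabulate (λ e∈ eq → All.lookup x∉ (∈-choose⁻ xs e∈) (cong proj₁ eq)) ∷ choose-unique xs!
    ... | no  _ = choose-unique xs!

    ∈-elements : ∀ e → e ∈ elements S
    ∈-elements e = ∈-choose⁺ (subsets n) e (∈-subsets (proj₁ e))

  size : ℕ
  size = length (elements S)

  at : Fin size → El S
  at = lookup (elements S)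

  index : El S → Fin size
  index e = Any.index (∈-elements e)

  at-index : ∀ e → at (index e) ≡ e
  at-index e = sym (Any.lookup-index (∈-elements e))

  index-at : ∀ i → index (at i) ≡ i
  index-at i = lookup-injective (choose-unique (subsets-unique n)) (at-index (at i))

-- Entries of the incidence matrix.

∣-1^n∣≡1 : ∀ n → ∣ -1ℤ ℤ.^ n ∣ ≡ 1
∣-1^n∣≡1 zero    = refl
∣-1^n∣≡1 (suc n) = trans (ℤ.abs-* -1ℤ (-1ℤ ℤ.^ n)) (cong (1 ℕ.*_) (∣-1^n∣≡1 n))

-- A nonzero entry is a sign and occurs only where r is f with one vertex removed, hence where r ⊂
-- f. This turns the terms of the determinant into fitting orientations.
∣∂∣≤ : ∀ {n} (r f : Subset n) → ∣ ∂[ r , f ] ∣ ℕ.≤ (if ⌊ r ⊂? f ⌋ then 1 else 0)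
∣∂∣≤ r f with Fin.any? (λ v → (v ∈? f) ×-dec (Vec.≡-dec Bool._≟_ r (f Subset.- v)))
... | no  _               = ℕ.z≤n
... | yes (v , v∈f , refl) with (f Subset.- v) ⊂? f
...   | yes _   = ℕ.≤-reflexive (∣-1^n∣≡1 (position f v))
...   | no  r⊄f = contradiction (x∈p⇒p-x⊂p v∈f) r⊄f

-- Passage from real independence to integer injectivity.

module _ (K : CommutativeRing 0ℓ 0ℓ) where
  open CommutativeRing K hiding (zero)
    renaming (refl to ≈-refl; sym to ≈-sym; trans to ≈-trans; _+_ to _⊹_; _*_ to _✶_; +-cong to ⊹-cong)
  open SemiringSum semiring
  open CommutativeSemigroupProperties *-commutativeSemigroup using () renaming (x∙yz≈y∙xz to x✶yz≈y✶xz)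
  open SetoidReasoning (CommutativeRing.setoid K) using (step-≈-⟩; step-≈-⟨)
    renaming (begin_ to begin≈_; _∎ to _∎≈)

  sum-zero : ∀ {n} {x : Fin n → Carrier} → (∀ i → x i ≈ 0#) → sum x ≈ 0#
  sum-zero {n} x≈0 = ≈-trans (sum-cong-≋ x≈0) (sum-replicate-zero n)

  δ : ∀ {n} → Fin n → Fin n → Carrier
  δ i j = if does (i Fin.≟ j) then 1# else 0#

  sum-δ : ∀ {n} (k : Fin n) x → sum (λ i → δ i k ✶ x i) ≈ x k
  sum-δ zero    x = ≈-trans (⊹-cong (*-identityˡ _) (sum-zero λ i → zeroˡ (x (suc i)))) (+-identityʳ _)
  sum-δ (suc k) x = ≈-trans (⊹-cong (zeroˡ _) (sum-δ k (tail x))) (+-identityˡ _)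

  ∑-δ : ∀ {n} (S : Family n) e (x : El S → Carrier) →
        x e ≈ ∑ +-commutativeMonoid S (λ s → δ (index S s) (index S e) ✶ x s)
  ∑-δ S e x = ≈-sym (begin≈
    sum (λ i → δ (index S (at S i)) (index S e) ✶ x (at S i))
      ≈⟨ sum-cong-≋ (λ i → reflexive (cong (λ k → δ k (index S e) ✶ x (at S i)) (index-at S i))) ⟩
    sum (λ i → δ i (index S e) ✶ x (at S i))
      ≈⟨ sum-δ (index S e) (x ∘ at S) ⟩
    x (at S (index S e))
      ≈⟨ reflexive (cong x (at-index S e)) ⟩
    x e ∎≈)

  -- Interchanging the two sums turns the pairing with `y` into a combination of the pairings with
  -- the rows of `A`, all of which vanish.
  orthogonal-to-span : ∀ {m n} (S : Family m) (S′ : Family n) (A : El S → El S′ → Carrier)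
    (b : El S → Carrier) (c y : El S′ → Carrier) →
    (∀ t → y t ≈ ∑ +-commutativeMonoid S λ s → b s ✶ A s t) →
    (∀ s → ∑ +-commutativeMonoid S′ (λ t → c t ✶ A s t) ≈ 0#) →
    ∑ +-commutativeMonoid S′ (λ t → c t ✶ y t) ≈ 0#
  orthogonal-to-span S S′ A b c y y≈ A⊥c = begin≈
    sum (λ j → c′ j ✶ y (at S′ j))
      ≈⟨ sum-cong-≋ (λ j → *-congˡ {c′ j} (y≈ (at S′ j))) ⟩
    sum (λ j → c′ j ✶ sum λ i → b′ i ✶ A′ i j)
      ≈⟨ sum-cong-≋ (λ j → *-distribˡ-sum (c′ j) (λ i → b′ i ✶ A′ i j)) ⟩
    sum (λ j → sum λ i → c′ j ✶ (b′ i ✶ A′ i j))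
      ≈⟨ ∑-comm (λ j i → c′ j ✶ (b′ i ✶ A′ i j)) ⟩
    sum (λ i → sum λ j → c′ j ✶ (b′ i ✶ A′ i j))
      ≈⟨ sum-cong-≋ (λ i → sum-cong-≋ λ j → x✶yz≈y✶xz (c′ j) (b′ i) (A′ i j)) ⟩
    sum (λ i → sum λ j → b′ i ✶ (c′ j ✶ A′ i j))
      ≈⟨ sum-cong-≋ (λ i → *-distribˡ-sum (b′ i) (λ j → c′ j ✶ A′ i j)) ⟨
    sum (λ i → b′ i ✶ sum λ j → c′ j ✶ A′ i j)
      ≈⟨ sum-zero (λ i → ≈-trans (*-congˡ {b′ i} (A⊥c (at S i))) (zeroʳ (b′ i))) ⟩
    0# ∎≈
    where
    b′ = b ∘ at S
    c′ = c ∘ at S′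
    A′ : Fin (size S) → Fin (size S′) → Carrier
    A′ i j = A (at S i) (at S′ j)

  module _ (φ : ℤ → Carrier) (φ-0 : φ 0ℤ ≈ 0#)
           (φ-+ : ∀ i j → φ (i + j) ≈ φ i ⊹ φ j) (φ-* : ∀ i j → φ (i * j) ≈ φ i ✶ φ j) where

    sum-homomorphism : ∀ {n} (a x : ℤ^ n) → sum (λ i → φ (x i) ✶ φ (a i)) ≈ φ (apply (dot a) x)
    sum-homomorphism {zero}  a x = ≈-sym φ-0
    sum-homomorphism {suc n} a x = begin≈
      φ (x zero) ✶ φ (a zero) ⊹ sum (λ i → φ (x (suc i)) ✶ φ (a (suc i)))
        ≈⟨ ⊹-cong (≈-trans (*-comm _ _) (≈-sym (φ-* _ _))) (sum-homomorphism (tail a) (tail x)) ⟩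
      φ (a zero * x zero) ⊹ φ (apply (dot (tail a)) (tail x))
        ≈⟨ φ-+ _ _ ⟨
      φ (apply (dot a) x) ∎≈

    -- v is not replaced by φ ∘ a, as comparing products of reals up to unfolding is intractable.
    orthogonal : ∀ {n} (S : Family n) (v : El S → Carrier) (a : El S → ℤ) (x : ℤ^ (size S)) →
                 (∀ s → v s ≡ φ (a s)) → apply (dot (a ∘ at S)) x ≡ 0ℤ →
                 ∑ +-commutativeMonoid S (λ s → φ (x (index S s)) ✶ v s) ≈ 0#
    orthogonal S v a x v≡ a⊥x = begin≈
      sum (λ i → φ (x (index S (at S i))) ✶ v (at S i))
        ≈⟨ sum-cong-≋ (λ i → reflexive (cong₂ (λ j y → φ (x j) ✶ y) (index-at S i) (v≡ (at S i)))) ⟩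
      sum (λ i → φ (x i) ✶ φ (a (at S i))) ≈⟨ sum-homomorphism (a ∘ at S) x ⟩
      φ (apply (dot (a ∘ at S)) x)         ≈⟨ reflexive (cong φ a⊥x) ⟩
      φ 0ℤ                                 ≈⟨ φ-0 ⟩
      0#                                   ∎≈

private
  module ℛ = CommutativeRing Reals.commutativeRing

i/1≡ : ∀ i → i ℚ./ 1 ≡ mkℚ i 0 (coprime-sym (1-coprimeTo ∣ i ∣))
i/1≡ i = ℚ.↥p/↧p≡p (mkℚ i 0 (coprime-sym (1-coprimeTo ∣ i ∣)))

fromℤ-+ : ∀ i j → fromℤ (i + j) ℛ.≈ fromℤ i ℛ.+ fromℤ j
fromℤ-+ i j = Reals.pointwise (fromℤ (i + j)) (fromℤ i ℛ.+ fromℤ j) λ _ →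
  trans (cong (ℚ._/ 1) (sym (cong₂ _+_ (ℤ.*-identityʳ i) (ℤ.*-identityʳ j))))
    (sym (cong₂ ℚ._+_ (i/1≡ i) (i/1≡ j)))

fromℤ-* : ∀ i j → fromℤ (i * j) ℛ.≈ fromℤ i ℛ.* fromℤ j
fromℤ-* i j = Reals.pointwise (fromℤ (i * j)) (fromℤ i ℛ.* fromℤ j) λ _ →
  sym (cong₂ ℚ._*_ (i/1≡ i) (i/1≡ j))

-- The tolerance 1 suffices: an integer of absolute value below 1 is zero.
fromℤ≈0⇒≡0 : ∀ i → fromℤ i ℛ.≈ ℛ.0# → i ≡ 0ℤ
fromℤ≈0⇒≡0 i i≈0 with i≈0 1ℚ (ℚ.positive⁻¹ 1ℚ)
... | N , close with subst (λ q → ℚ.∣ q ∣ ℚ.< 1ℚ) (trans (ℚ.+-identityʳ (i ℚ./ 1)) (i/1≡ i)) (close N ℕ.≤-refl)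
...   | *<* i<1 = ℤ.∣i∣≡0⇒i≡0 (ℕ.n<1⇒n≡0 (ℤ.drop‿+<+ (subst (ℤ._< 1ℤ) (ℤ.*-identityʳ (+ ∣ i ∣)) i<1)))

module _ {n} (G : SimplicialComplex n) (d : ℕ) (F S : Family n) where

  incidence : Fin (size S) → Fin (size F) → ℤ
  incidence i j = ∂[ proj₁ (at S i) , proj₁ (at F j) ]

  private
    ℝ-orthogonal = orthogonal Reals.commutativeRing fromℤ
      (Reals.pointwise (fromℤ 0ℤ) ℛ.0# λ _ → refl) fromℤ-+ fromℤ-*

  -- A vector killed by the rows in `S` is killed by everything they span, hence by all rows. It is
  -- then a relation between the full columns, which are independent.
  incidence-injective : LinearlyIndependent F (columns G d F) →
    (∀ r → Span S (rows G d F S) (rows G d F (G ⟨ d ⟩) r)) →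
    ∀ w → matrix incidence · w ≗ 𝟎 → w ≗ 𝟎
  incidence-injective independent span w Aw≗𝟎 j = subst (λ j → w j ≡ 0ℤ) (index-at F j)
    (fromℤ≈0⇒≡0 (w (index F (at F j))) (independent (λ f → fromℤ (w (index F f))) vanishes (at F j)))
    where
    row⊥w : ∀ (s : El S) → apply (dot λ j → ∂[ proj₁ s , proj₁ (at F j) ]) w ≡ 0ℤ
    row⊥w s = trans
      (cong (λ s → apply (dot λ j → ∂[ proj₁ s , proj₁ (at F j) ]) w) (sym (at-index S s)))
      (Aw≗𝟎 (index S s))
    vanishes : ∀ r → ℝ-combination F (λ f → fromℤ (w (index F f))) (columns G d F) r ℛ.≈ ℛ.0#
    vanishes r = let b , row≈ = span r in
      orthogonal-to-span Reals.commutativeRing S F (rows G d F S) b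
        (λ f → fromℤ (w (index F f))) (λ f → columns G d F f r) row≈
        λ s → ℝ-orthogonal F (rows G d F S s) (λ f → ∂[ proj₁ s , proj₁ f ]) w (λ _ → refl) (row⊥w s)

  incidenceᵀ-injective : LinearlyIndependent S (rows G d F S) →
    ∀ u → matrix (λ j i → incidence i j) · u ≗ 𝟎 → u ≗ 𝟎
  incidenceᵀ-injective independent u Aᵀu≗𝟎 i = subst (λ i → u i ≡ 0ℤ) (index-at S i)
    (fromℤ≈0⇒≡0 (u (index S (at S i))) (independent (λ s → fromℤ (u (index S s))) vanishes (at S i)))
    where
    column⊥u : ∀ (f : El F) → apply (dot λ i → ∂[ proj₁ (at S i) , proj₁ f ]) u ≡ 0ℤ
    column⊥u f = trans
      (cong (λ f → apply (dot λ i → ∂[ proj₁ (at S i) , proj₁ f ]) u) (sym (at-index F f)))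
      (Aᵀu≗𝟎 (index F f))
    vanishes : ∀ f → ℝ-combination S (λ s → fromℤ (u (index S s))) (rows G d F S) f ℛ.≈ ℛ.0#
    vanishes f = ℝ-orthogonal S (λ s → rows G d F S s f) (λ s → ∂[ proj₁ s , proj₁ f ]) u (λ _ → refl) (column⊥u f)

row∈RowSpace : ∀ {n} (G : SimplicialComplex n) d F r → RowSpace G d F (rows G d F (G ⟨ d ⟩) r)
row∈RowSpace G d F r =
  (λ s → δ Reals.commutativeRing (index (G ⟨ d ⟩) s) (index (G ⟨ d ⟩) r)) ,
  (λ f → ∑-δ Reals.commutativeRing (G ⟨ d ⟩) r λ s → rows G d F (G ⟨ d ⟩) s f)

-- Squareness is obtained without a notion of rank: neither the matrix nor its transpose has a
-- kernel, so by `wide⇒Kernel` neither is wider than it is tall.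
incidence-nonsingular : ∀ {n} (G : SimplicialComplex n) d F R → IsRootedForest G d F R →
  (size (complement G d R) ≡ size F) ×
  (∀ w → matrix (incidence G d F (complement G d R)) · w ≗ 𝟎 → w ≗ 𝟎)
incidence-nonsingular G d F R ((_ , columns-independent) , _ , _ , rows-independent , rows-span) =
    ℕ.≤-antisym
      (ℕ.≮⇒≥ (injective⇒¬Kernel Aᵀ Aᵀ-injective ∘ wide⇒Kernel Aᵀ))
      (ℕ.≮⇒≥ (injective⇒¬Kernel A A-injective ∘ wide⇒Kernel A))
  , A-injective
  where
  A  = matrix (incidence G d F (complement G d R))
  Aᵀ = matrix (λ j i → incidence G d F (complement G d R) i j)
  A-injective = incidence-injective G d F (complement G d R) columns-independent
    λ r → rows-span (rows G d F (G ⟨ d ⟩) r) (row∈RowSpace G d F r)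
  Aᵀ-injective = incidenceᵀ-injective G d F (complement G d R) rows-independent

-- Fitting orientations as matchings.

matchings : ∀ {p q} → (Fin p → Fin q → Bool) → Setoid 0ℓ 0ℓ
matchings {p} {q} P = record
  { Carrier = Σ[ π ∈ Permutation p q ] Fits P π
  ; _≈_ = λ (π , _) (ρ , _) → π Perm.≈ ρ
  ; isEquivalence = record
    { refl = λ _ → refl
    ; sym = λ π≈ρ r → sym (π≈ρ r)
    ; trans = λ π≈ρ ρ≈σ r → trans (π≈ρ r) (ρ≈σ r) } }

matchings-cardinality : ∀ {n} (P : Fin n → Fin n → Bool) → HasCardinality (matchings P) (count P)
matchings-cardinality P = injective∧surjective⇒inverse (matchings P)
  (λ k → matching P k , matching-fits P k) (matching-injective P)
  λ (π , fits) → matching-surjective P π fits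

-- The sizes `p` and `q` are variables so that matching on `refl` makes the matrix square; the two
-- list lengths it is used for could not be unified.
index≤matchings : ∀ {p q} (A : Fin p → Fin q → ℤ) (P : Fin p → Fin q → Bool) → p ≡ q →
  (∀ r c → ℤ.∣ A r c ∣ ℕ.≤ (if P r c then 1 else 0)) → (∀ w → matrix A · w ≗ 𝟎 → w ≗ 𝟎) →
  ∃₂ λ N h → HasCardinality (matchings P) N × Index (matrix A) h × h ℕ.≤ N
index≤matchings A P refl A≤P injective with det A
... | z , inj₁ (_ , K) = contradiction K (injective⇒¬Kernel (matrix A) injective)
... | z , D@(inj₂ (_ , I)) = count P , ℤ.∣ z ∣ , matchings-cardinality P , I , ∣det∣≤count A P A≤P D

El↔Fin : ∀ {n} (S : Family n) → El S ↔ Fin (size S)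
El↔Fin S = mk↔ₛ′ (index S) (at S) (index-at S) (at-index S)

module _ {n} (G : SimplicialComplex n) (d : ℕ) (F R : Family n) where
  private
    R̄ = complement G d R
    A = incidence G d F R̄

  contains : Fin (size R̄) → Fin (size F) → Bool
  contains i j = ⌊ proj₁ (at R̄ i) ⊂? proj₁ (at F j) ⌋

  matchings↔fittingOrientations : Inverse (matchings contains) (fittingOrientations G d F R)
  matchings↔fittingOrientations = record
    { to = toOrientation
    ; from = toMatching
    ; to-cong = λ π≈ρ r → cong (at F) (π≈ρ (index R̄ r))
    ; from-cong = λ φ≈ψ i → cong (index F) (φ≈ψ (at R̄ i))
    ; inverse = (λ {φ} {π} π≈ r → trans (cong (at F) (π≈ (index R̄ r)))
                  (trans (at-index F _) (cong (Bijection.to (orient φ)) (at-index R̄ r))))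
              , (λ {π} {φ} φ≈ i → trans (cong (index F) (φ≈ (at R̄ i)))
                  (trans (index-at F _) (cong (proj₁ π ⟨$⟩ʳ_) (index-at R̄ i)))) }
    where
    toOrientation : Setoid.Carrier (matchings contains) → FittingOrientation G d F R
    toOrientation (π , fitting) = record
      { orient = ↔⇒⤖ (↔-sym (El↔Fin F) ↔-∘ (π ↔-∘ El↔Fin R̄))
      ; fits = λ r → subst (λ s → proj₁ s ⊂ proj₁ (at F (π ⟨$⟩ʳ index R̄ r))) (at-index R̄ r)
          (toWitness (fitting (index R̄ r))) }
    toMatching : FittingOrientation G d F R → Setoid.Carrier (matchings contains)
    toMatching φ = El↔Fin F ↔-∘ (⤖⇒↔ (orient φ) ↔-∘ ↔-sym (El↔Fin R̄)) , λ i → fromWitness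
      (subst (λ f → proj₁ (at R̄ i) ⊂ proj₁ f) (sym (at-index F _)) (fits φ (at R̄ i)))

-- Relative homology as the cokernel of the reduced incidence matrix.

extendByZero-∈ : ∀ {n} (S : Family n) z (s : El S) → extendByZero S z (proj₁ s) ≡ z s
extendByZero-∈ S z (s , s∈S) with T? (S s)
... | yes _   = cong z (El-≡ S refl)
... | no  s∉S = contradiction s∈S s∉S

extendByZero-∉ : ∀ {n} (S : Family n) z {s} → ¬ s ∈ᶠ S → extendByZero S z s ≡ 0ℤ
extendByZero-∉ S z {s} s∉S with T? (S s)
... | yes s∈S = contradiction s∈S s∉S
... | no  _   = refl

∈-∖⁻ : ∀ {n} (S S′ : Family n) {s} → s ∈ᶠ S ∖ S′ → s ∈ᶠ S × ¬ s ∈ᶠ S′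
∈-∖⁻ S S′ {s} _ with S s | S′ s
... | true | false = _ , λ ()

∈-∖⁺ : ∀ {n} (S S′ : Family n) {s} → s ∈ᶠ S → ¬ s ∈ᶠ S′ → s ∈ᶠ S ∖ S′
∈-∖⁺ S S′ {s} _ s∉S′ with S s | S′ s
... | true | false = _
... | true | true  = s∉S′ _

module _ {n} (G : SimplicialComplex n) (d : ℕ) (F R : Family n) (R⊆ : R ⊆ᶠ G ⟨ d ⟩) where
  private
    R̄ = complement G d R
    A = incidence G d F R̄
    open AbelianGroup (RelativeHomology G d F R) using (_≈_)

    embed : El R̄ → El (G ⟨ d ⟩)
    embed (s , s∈R̄) = s , proj₁ (∈-∖⁻ (G ⟨ d ⟩) R s∈R̄)

    restrict : (El (G ⟨ d ⟩) → ℤ) → ℤ^ (size R̄)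
    restrict x i = x (embed (at R̄ i))

    extend₀ : ℤ^ (size R̄) → El (G ⟨ d ⟩) → ℤ
    extend₀ z r = extendByZero R̄ (z ∘ index R̄) (proj₁ r)

    restrict-extend₀ : ∀ z → restrict (extend₀ z) ≗ z
    restrict-extend₀ z i = trans (extendByZero-∈ R̄ (z ∘ index R̄) (at R̄ i)) (cong z (index-at R̄ i))

    ∂F : (El F → ℤ) → El (G ⟨ d ⟩) → ℤ
    ∂F = GroupHomomorphism.⟦_⟧ (boundary F (G ⟨ d ⟩))

    ∂F-matrix : ∀ a i → ∂F a (embed (at R̄ i)) ≡ apply (matrix A i) (a ∘ at F)
    ∂F-matrix a i = sym (dot-sum (A i) (a ∘ at F))

    -- The relation comes from two nested cokernels: `a` is the chain on F and `b` the correction in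
    -- ℤR. The latter vanishes on faces outside R.
    ≈⇒Congruent : ∀ x y → x ≈ y → Congruent (matrix A) (restrict x) (restrict y)
    ≈⇒Congruent x y (a , b , x≡) = a ∘ at F , λ i → begin
      x (embed (at R̄ i))
        ≡⟨ x≡ (embed (at R̄ i)) ⟩
      (y (embed (at R̄ i)) + ∂F a (embed (at R̄ i))) + extendByZero R b (proj₁ (at R̄ i))
        ≡⟨ cong₂ (λ u v → (y (embed (at R̄ i)) + u) + v) (∂F-matrix a i)
             (extendByZero-∉ R b (proj₂ (∈-∖⁻ (G ⟨ d ⟩) R (proj₂ (at R̄ i))))) ⟩
      (y (embed (at R̄ i)) + apply (matrix A i) (a ∘ at F)) + 0ℤ
        ≡⟨ ℤ.+-identityʳ _ ⟩
      y (embed (at R̄ i)) + apply (matrix A i) (a ∘ at F) ∎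

    Congruent⇒≈ : ∀ x y → Congruent (matrix A) (restrict x) (restrict y) → x ≈ y
    Congruent⇒≈ x y (w , x≡) = a , b , equal
      where
      a : El F → ℤ
      a = w ∘ index F
      b : El R → ℤ
      -- On R any discrepancy is allowed, so `b` is taken to be exactly the one that is left.
      b (s , s∈R) = x r + - (y r + ∂F a r) where r = s , R⊆ s∈R
      cancel : ∀ u v → u ≡ v + (u + - v)
      cancel = solve-∀
      embed-at : ∀ r (r∈R̄ : proj₁ r ∈ᶠ R̄) → embed (at R̄ (index R̄ (proj₁ r , r∈R̄))) ≡ r
      embed-at r r∈R̄ = El-≡ (G ⟨ d ⟩) (cong proj₁ (at-index R̄ (proj₁ r , r∈R̄)))
      restricted : ∀ i → x (embed (at R̄ i)) ≡ y (embed (at R̄ i)) + ∂F a (embed (at R̄ i))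
      restricted i = trans (x≡ i) (cong (_+_ (y (embed (at R̄ i))))
        (trans (respects (matrix A i) (λ j → cong w (sym (index-at F j)))) (sym (∂F-matrix a i))))
      equal : ∀ r → x r ≡ (y r + ∂F a r) + extendByZero R b (proj₁ r)
      equal r with T? (R (proj₁ r))
      ... | yes r∈R = trans (cancel (x r) (y r + ∂F a r))
                        (cong (λ r′ → (y r + ∂F a r) + (x r′ + - (y r′ + ∂F a r′))) (El-≡ (G ⟨ d ⟩) refl))
      ... | no  r∉R = let r∈R̄ = ∈-∖⁺ (G ⟨ d ⟩) R (proj₂ r) r∉R in
        trans (subst (λ r → x r ≡ y r + ∂F a r) (embed-at r r∈R̄) (restricted (index R̄ (proj₁ r , r∈R̄))))
          (sym (ℤ.+-identityʳ _))

  -- Restriction to the faces outside R reflects and preserves the relations, and extension by zero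
  -- is a section of it, so classes and representatives carry over.
  homology-cardinality : ∀ {h} → Index (matrix A) h →
                         HasCardinality (AbelianGroup.setoid (RelativeHomology G d F R)) h
  homology-cardinality I = injective∧surjective⇒inverse _ (λ k → extend₀ (rep I k))
    (λ {k} {l} k≈l → trans (sym (class-restrict k)) (trans (sound I
      (≈⇒Congruent (extend₀ (rep I k)) (extend₀ (rep I l)) k≈l)) (class-restrict l)))
    (λ x → class I (restrict x) , Congruent⇒≈ _ x (complete I (class-restrict (class I (restrict x)))))
    where
    class-restrict : ∀ k → class I (restrict (extend₀ (rep I k))) ≡ k
    class-restrict k = trans (sound I (≗⇒Congruent (matrix A) (restrict-extend₀ (rep I k)))) (class-rep I k)

proposition28 : ∀ {n} (G : SimplicialComplex n) (d : ℕ) → HasDimension G d →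
    (F R : Family n) → IsRootedForest G d F R →
    (∃₂ λ N h →
    HasCardinality (fittingOrientations G d F R) N ×
    HasCardinality (AbelianGroup.setoid (RelativeHomology G d F R)) h ×
    N ≥ h)
    × FittingOrientation G d F R
proposition28 G d _ F R rooted =
  let square , injective = incidence-nonsingular G d F R rooted
      N , h , enumeration , I , h≤N = index≤matchings (incidence G d F (complement G d R)) (contains G d F R)
        square (λ i j → ∣∂∣≤ (proj₁ (at (complement G d R) i)) (proj₁ (at F j))) injective
      orientations = inverse enumeration (matchings↔fittingOrientations G d F R)
  in (N , h , orientations , homology-cardinality G d F R (proj₁ (proj₂ rooted)) I , h≤N)
   -- The class of zero is an element of `Fin h`; as h ≤ N, it also indexes a fitting orientation.
   , Inverse.to orientations (inject≤ (class I 𝟎) h≤N)
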